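{- For every $k$ with $2 \le k \le n$ (where $k$ may depend on $n$), the worst-case approximation ratio of the grammar-based compressor LZ78 satisfies $$\alpha_{\mathrm{LZ78}}(k,n) \in \Theta\left((n/\log n)^{2/3}\right).$$ That is, there are constants $c_1,c_2>0$ and $n_0$ such that for all $n\ge n_0$ and all $k$ with $2\le k\le n$ we have $c_1(n/\log n)^{2/3}\le \alpha_{\mathrm{LZ78}}(k,n)\le c_2(n/\log n)^{2/3}$.
   Context: A straight-line program (SLP) over a finite alphabet $\Sigma$ is a context-free grammar $\mathbb{A}=(N,\Sigma,P,S)$ with a finite set $N$ of nonterminals ($N\cap\Sigma=\emptyset$), start nonterminal $S\in N$, and a finite set $P$ of productions $A\to w$ with $A\in N$, $w\in(N\cup\Sigma)^+$, such that (i) for every $A\in N$ there is exactly one production with left-hand side $A$, and (ii) the relation $\{(A,B)\in N\times N \mid (A\to w)\in P,\ B \text{ occurs in } w\}$ is acyclic. Every nonterminal $A$ produces a unique word $\mathrm{val}(A)\in\Sigma^+$, and $\mathrm{val}(\mathbb{A})=\mathrm{val}(S)$. The size of $\mathbb{A}$ is $|\mathbb{A}|=\sum_{(A\to w)\in P}|w|$. For a nonempty word $w$, $g(w)$ denotes the size of a smallest SLP producing $w$. A grammar-based compressor $\mathcal{C}$ computes for each nonempty word $w$ an SLP $\mathcal{C}(w)$ with $\mathrm{val}(\mathcal{C}(w))=w$. With $[1,k]=\{1,\dots,k\}$, its worst-case approximation ratio is $$\alpha_{\mathcal{C}}(k,n)=\max\{|\mathcal{C}(w)|/g(w) \mid w\in[1,k]^n\}.$$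 LZ78: the LZ78-factorization of $w\in\Sigma^+$ is the unique list of words $f_1,\dots,f_\ell$ with $w=f_1\cdots f_\ell$ such that, with $f_0=\varepsilon$ (the empty word): $f_i\ne f_j$ for all $0\le i,j\le \ell-1$ with $i\ne j$; for all $1\le i\le \ell-1$ there exist $0\le j<i$ and $a\in\Sigma$ with $f_i=f_ja$; and $f_\ell=f_i$ for some $0\le i\le \ell-1$. (Equivalently, reading left to right, $f_k$ is the shortest prefix of the unprocessed suffix that differs from all $f_i$, $i<k$; if no such prefix exists, $f_\ell$ is the possibly empty unprocessed suffix.) The SLP produced by LZ78 has nonterminals $S,F_1,\dots,F_{\ell-1}$; for $1\le i\le \ell-1$ with $f_i=f_ja$ it has the rule $F_i\to F_ja$ if $j\ge 1$ and $F_i\to a$ if $j=0$; and the start rule is $S\to F_1\cdots F_{\ell-1}F_i$ where $f_\ell=f_i$ (the last symbol being omitted if $f_\ell=\varepsilon$). -}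

module Defs where

open import Data.Empty using (⊥-elim)
open import Data.Fin as Fin using (Fin; zero; suc; toℕ; fromℕ; inject₁)
import Data.Fin.Induction as FinInd
import Data.Fin.Properties as Fin
open import Data.Fin.Relation.Unary.Top using (view; ‵fromℕ; ‵inj₁)
open import Data.Integer using (+_; ∣_∣)
open import Data.List as List using (List; []; _∷_; _++_; concat; tabulate)
import Data.List.Extrema
open import Data.List.Membership.Propositional using (_∈_; find; lose)
open import Data.List.Membership.Propositional.Properties
  using (∈-++⁺ˡ; ∈-++⁺ʳ; ∈-++⁻; ∈-allFin; ∈-map⁺; ∈-tabulate⁻; ∈-cartesianProductWith⁺)
import Data.List.Properties as List
open import Data.List.NonEmpty as List⁺ using (List⁺; _∷_)
open import Data.List.Relation.Unary.Any using (Any; here; there; any?)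
open import Data.Nat as ℕ using (ℕ; zero; suc; s≤s; z≤n; NonZero)
open import Data.Nat.Induction using (<-rec)
import Data.Nat.Properties as ℕ
open import Data.Product using (Σ; ∃; ∃₂; ∃-syntax; _×_; _,_; proj₁; proj₂)
open import Data.Rational as ℚ using (ℚ; 0ℚ; _/_; ↥_; ↧ₙ_)
import Data.Rational.Properties as ℚ
open import Data.Sum using (_⊎_; inj₁; inj₂)
import Data.Sum.Properties as Sum
open import Data.Vec as Vec using (Vec; []; _∷_)
import Data.Vec.Properties as Vec
open import Data.Vec.Relation.Unary.All using (All; []; _∷_)
open import Function using (_∘_; flip; id)
open import Induction.WellFounded using (WellFounded; module Subrelation; module All)
open import Level using (0ℓ)
open import Relation.Binary.Bundles using (DecTotalOrder)
open import Relation.Binary.Construct.Closure.Transitive as Plus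
  using (TransClosure; [_]; _∷_)
open import Relation.Binary.PropositionalEquality
open import Relation.Nullary using (¬_; Dec; yes; no; ¬?)
open import Relation.Nullary.Decidable using (map′; _×-dec_; _⊎-dec_)

-- The alphabet [1,k] is Fin k; the nonterminals are the elements of Fin N.
Symbol : ℕ → ℕ → Set
Symbol k N = Fin N ⊎ Fin k

Rules : ℕ → ℕ → Set
Rules k N = Vec (List⁺ (Symbol k N)) N

private variable
  k N : ℕ

rhs : Rules k N → Fin N → List (Symbol k N)
rhs R A = List⁺.toList (Vec.lookup R A)

Uses : Rules k N → Fin N → Fin N → Set
Uses R A B = inj₁ B ∈ rhs R A

Acyclic : Rules k N → Set
Acyclic R = ∀ A → ¬ TransClosure (Uses R) A A

record SLP (k : ℕ) : Set where
  field
    {#N}    : ℕ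
    rules   : Rules k #N
    start   : Fin #N
    acyclic : Acyclic rules

  size : ℕ
  size = Vec.sum (Vec.map List⁺.length rules)

open SLP public using (size)

infix 4 _⊢_⇒_ _⊢_⇒*_

mutual
  data _⊢_⇒_ (R : Rules k N) : Symbol k N → List (Fin k) → Set where
    term : ∀ {a} → R ⊢ inj₂ a ⇒ List.[ a ]
    rule : ∀ {A u} → R ⊢ rhs R A ⇒* u → R ⊢ inj₁ A ⇒ u

  data _⊢_⇒*_ (R : Rules k N) : List (Symbol k N) → List (Fin k) → Set where
    []  : R ⊢ [] ⇒* []
    _∷_ : ∀ {s ss u v} → R ⊢ s ⇒ u → R ⊢ ss ⇒* v → R ⊢ s ∷ ss ⇒* u ++ v

module _ {R : Rules k N} where
  mutual
    ⇒-unique : ∀ {s u v} → R ⊢ s ⇒ u → R ⊢ s ⇒ v → u ≡ v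
    ⇒-unique term     term     = refl
    ⇒-unique (rule d) (rule e) = ⇒*-unique d e

    ⇒*-unique : ∀ {ss u v} → R ⊢ ss ⇒* u → R ⊢ ss ⇒* v → u ≡ v
    ⇒*-unique []       []       = refl
    ⇒*-unique (d ∷ ds) (e ∷ es) = cong₂ _++_ (⇒-unique d e) (⇒*-unique ds es)

  ⇒*-++ : ∀ {ss ts u v} → R ⊢ ss ⇒* u → R ⊢ ts ⇒* v → R ⊢ ss ++ ts ⇒* u ++ v
  ⇒*-++ []       es = es
  ⇒*-++ (_∷_ {u = u} {v} d ds) es =
    subst (R ⊢ _ ⇒*_) (sym (List.++-assoc u v _)) (d ∷ ⇒*-++ ds es)

module _ (R : Rules k N) where
  uses-wf : Acyclic R → WellFounded (flip (Uses R))
  uses-wf acyclic = Subrelation.wellFounded {_<₂_ = flip (TransClosure (Uses R))} [_]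
    (FinInd.spo-noetherian record
    { isEquivalence = isEquivalence
    ; irrefl        = λ { refl → acyclic _ }
    ; trans         = Plus._++_
    ; <-resp-≈      = resp₂ _
    })

  derive : Acyclic R → ∀ A → ∃ λ u → R ⊢ inj₁ A ⇒ u
  derive acyclic = All.wfRec (uses-wf acyclic) 0ℓ _ step
    where
    step : ∀ A → (∀ {B} → Uses R A B → ∃ λ u → R ⊢ inj₁ B ⇒ u) →
           ∃ λ u → R ⊢ inj₁ A ⇒ u
    step A rec = let u , d = go (rhs R A) id in u , rule d
      where
      go : ∀ ss → (∀ {B} → inj₁ B ∈ ss → Uses R A B) → ∃ λ u → R ⊢ ss ⇒* u
      go []            _ = [] , []
      go (inj₁ B ∷ ss) h =
        let _ , d = rec (h (here refl)) ; _ , ds = go ss (h ∘ there) in _ , d ∷ ds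
      go (inj₂ a ∷ ss) h = let _ , ds = go ss (h ∘ there) in _ , term ∷ ds

val : SLP k → List (Fin k)
val 𝔸 = proj₁ (derive (SLP.rules 𝔸) (SLP.acyclic 𝔸) (SLP.start 𝔸))

val-unique : (𝔸 : SLP k) → ∀ {u} →
             SLP.rules 𝔸 ⊢ inj₁ (SLP.start 𝔸) ⇒ u → val 𝔸 ≡ u
val-unique 𝔸 = ⇒-unique (proj₂ (derive (SLP.rules 𝔸) (SLP.acyclic 𝔸) (SLP.start 𝔸)))

rank⇒acyclic : (R : Rules k N) (rank : Fin N → ℕ) →
               (∀ {A B} → Uses R A B → rank B ℕ.< rank A) → Acyclic R
rank⇒acyclic R rank decr A loop = ℕ.<-irrefl refl (decr⁺ loop)
  where
  decr⁺ : ∀ {A B} → TransClosure (Uses R) A B → rank B ℕ.< rank A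
  decr⁺ [ u ]    = decr u
  decr⁺ (u ∷ us) = ℕ.<-trans (decr⁺ us) (decr u)

Word : ℕ → Set
Word k = List⁺ (Fin k)

IsMinimum : (ℕ → Set) → ℕ → Set
IsMinimum P m = P m × (∀ n → P n → m ℕ.≤ n)

HasSLPOfSize : Word k → ℕ → Set
HasSLPOfSize {k} w s = ∃[ 𝔸 ] val {k} 𝔸 ≡ List⁺.toList w × size 𝔸 ≡ s

-- The minimum is taken over an infinite set of grammars, so its existence is
-- established by deciding HasSLPOfSize w s for every s.

minimum : {P : ℕ → Set} → (∀ n → Dec (P n)) → ∀ n → P n → ∃ (IsMinimum P)
minimum {P} P? = <-rec _ λ n rec pn → go n rec pn
  where
  go : ∀ n → (∀ {i} → i ℕ.< n → P i → ∃ (IsMinimum P)) → P n → ∃ (IsMinimum P)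
  go n rec pn with Fin.any? {n = n} (P? ∘ toℕ)
  ... | yes (i , pi) = rec (Fin.toℕ<n i) pi
  ... | no ¬p = n , pn , λ j pj → ℕ.≮⇒≥ λ j<n →
                  ¬p (Fin.fromℕ< j<n , subst P (sym (Fin.toℕ-fromℕ< j<n)) pj)

lists≤ : {A : Set} → List A → ℕ → List (List A)
lists≤ as zero    = [] ∷ []
lists≤ as (suc s) = [] ∷ List.cartesianProductWith _∷_ as (lists≤ as s)

∈-lists≤ : {A : Set} {as : List A} → (∀ a → a ∈ as) →
           ∀ {s} xs → List.length xs ℕ.≤ s → xs ∈ lists≤ as s
∈-lists≤ all {zero}  []       _       = here refl
∈-lists≤ all {suc s} []       _       = here refl
∈-lists≤ all {suc s} (x ∷ xs) (s≤s l) =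
  there (∈-cartesianProductWith⁺ _∷_ (all x) (∈-lists≤ all xs l))

vecs : {A : Set} → List A → ∀ n → List (Vec A n)
vecs as zero    = [] ∷ []
vecs as (suc n) = List.cartesianProductWith _∷_ as (vecs as n)

∈-vecs : {A : Set} {as : List A} {n : ℕ} {v : Vec A n} → All (_∈ as) v → v ∈ vecs as n
∈-vecs []       = here refl
∈-vecs (x ∷ xs) = ∈-cartesianProductWith⁺ _∷_ x (∈-vecs xs)

symbols : ∀ k N → List (Symbol k N)
symbols k N = List.map inj₁ (List.allFin N) ++ List.map inj₂ (List.allFin k)

∈-symbols : (s : Symbol k N) → s ∈ symbols k N
∈-symbols (inj₁ A) = ∈-++⁺ˡ (∈-map⁺ inj₁ (∈-allFin A))
∈-symbols (inj₂ a) = ∈-++⁺ʳ _ (∈-map⁺ inj₂ (∈-allFin a))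

rulesOfSize≤ : ∀ k N → ℕ → List (Rules k N)
rulesOfSize≤ k N s = vecs (List.cartesianProductWith _∷_ σ (lists≤ σ s)) N
  where σ = symbols k N

∈-rulesOfSize≤ : (R : Rules k N) → ∀ {s} →
                 Vec.sum (Vec.map List⁺.length R) ℕ.≤ s → R ∈ rulesOfSize≤ k N s
∈-rulesOfSize≤ {k} {N} R {s} = ∈-vecs ∘ go R
  where
  go : ∀ {n} (v : Vec (List⁺ (Symbol k N)) n) → Vec.sum (Vec.map List⁺.length v) ℕ.≤ s →
       All (_∈ List.cartesianProductWith _∷_ (symbols k N) (lists≤ (symbols k N) s)) v
  go []             _ = []
  go ((x ∷ xs) ∷ v) l =
    ∈-cartesianProductWith⁺ _∷_ (∈-symbols x)
      (∈-lists≤ ∈-symbols xs (ℕ.≤-trans (ℕ.≤-trans (ℕ.m≤m+n _ _) (ℕ.n≤1+n _)) l))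
    ∷ go v (ℕ.≤-trans (ℕ.m≤n+m _ (suc (List.length xs))) l)

N≤size : ∀ {A : Set} {n} (v : Vec (List⁺ A) n) → n ℕ.≤ Vec.sum (Vec.map List⁺.length v)
N≤size []             = z≤n
N≤size ((_ ∷ _) ∷ v) = s≤s (ℕ.≤-trans (N≤size v) (ℕ.m≤n+m _ _))

-- Paths whose intermediate vertices are all < i.
module Paths {N : ℕ} {E : Fin N → Fin N → Set} (E? : ∀ x y → Dec (E x y)) where

  Path : ∀ i → i ℕ.≤ N → Fin N → Fin N → Set
  Path zero    _ x y = E x y
  Path (suc i) l x y = Path i l′ x y ⊎ (Path i l′ x v × Path i l′ v y)
    where l′ = ℕ.<⇒≤ l
          v  = Fin.fromℕ< l

  path? : ∀ i l x y → Dec (Path i l x y)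
  path? zero    _ x y = E? x y
  path? (suc i) l x y = path? i _ x y ⊎-dec (path? i _ x _ ×-dec path? i _ _ y)

  sound : ∀ i l {x y} → Path i l x y → TransClosure E x y
  sound zero    l e              = [ e ]
  sound (suc i) l (inj₁ p)       = sound i _ p
  sound (suc i) l (inj₂ (p , q)) = sound i _ p Plus.++ sound i _ q

  embed : ∀ i l {x y} → E x y → Path i l x y
  embed zero    l e = e
  embed (suc i) l e = inj₁ (embed i _ e)

  compose : ∀ i l {x v y} → toℕ v ℕ.< i → Path i l x v → Path i l v y → Path i l x y
  compose (suc i) l {x} {v} {y} v<1+i p q with toℕ v ℕ.≟ i
  ... | yes eq = inj₂ (to p , from q)
    where
    v≡ : v ≡ Fin.fromℕ< l
    v≡ = Fin.toℕ-injective (trans eq (sym (Fin.toℕ-fromℕ< l)))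
    to : Path (suc i) l x v → Path i (ℕ.<⇒≤ l) x (Fin.fromℕ< l)
    to (inj₁ p)       = subst (Path i _ x) v≡ p
    to (inj₂ (p , _)) = p
    from : Path (suc i) l v y → Path i (ℕ.<⇒≤ l) (Fin.fromℕ< l) y
    from (inj₁ q)       = subst (λ z → Path i _ z y) v≡ q
    from (inj₂ (_ , q)) = q
  ... | no neq with ℕ.≤∧≢⇒< (ℕ.s≤s⁻¹ v<1+i) neq
  ...   | v<i with p | q
  ...     | inj₁ p       | inj₁ q         = inj₁ (compose i _ v<i p q)
  ...     | inj₁ p       | inj₂ (q , q′)  = inj₂ (compose i _ v<i p q , q′)
  ...     | inj₂ (p , p′) | inj₁ q        = inj₂ (p , compose i _ v<i p′ q)
  ...     | inj₂ (p , _) | inj₂ (_ , q)   = inj₂ (p , q)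

  complete : ∀ {x y} → TransClosure E x y → Path N ℕ.≤-refl x y
  complete [ e ]              = embed N _ e
  complete (_∷_ {y = v} e es) = compose N _ (Fin.toℕ<n v) (embed N _ e) (complete es)

acyclic? : (R : Rules k N) → Dec (Acyclic R)
acyclic? {N = N} R = Fin.all? λ A → ¬? (map′ (sound N _) complete (path? N ℕ.≤-refl A A))
  where
  uses? : ∀ A B → Dec (Uses R A B)
  uses? A B = any? (Sum.≡-dec Fin._≟_ Fin._≟_ (inj₁ B)) (rhs R A)
  open Paths uses?

hasSLPOfSize? : (w : Word k) (s : ℕ) → Dec (HasSLPOfSize w s)
hasSLPOfSize? {k} w s = map′ to from (Fin.any? λ N → any? (P? {toℕ N}) (rulesOfSize≤ k (toℕ N) s))
  where
  P : ∀ {N} → Rules k N → Set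
  P R = Σ (Acyclic R) λ ac → ∃ λ S →
    proj₁ (derive R ac S) ≡ List⁺.toList w × Vec.sum (Vec.map List⁺.length R) ≡ s

  P? : ∀ {N} (R : Rules k N) → Dec (P R)
  P? R with acyclic? R
  ... | no ¬ac = no (¬ac ∘ proj₁)
  ... | yes ac = map′ (ac ,_)
      (λ (ac′ , S , e , z) → S , trans (⇒-unique (proj₂ (derive R ac S)) (proj₂ (derive R ac′ S))) e , z)
      (Fin.any? λ S → List.≡-dec Fin._≟_ _ _ ×-dec (_ ℕ.≟ s))

  to : (∃ λ (N : Fin (suc s)) → Any P (rulesOfSize≤ k (toℕ N) s)) → HasSLPOfSize w s
  to (N , any) with find any
  ... | R , _ , ac , S , e , z = record { rules = R ; start = S ; acyclic = ac } , e , z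

  from : HasSLPOfSize w s → ∃ λ (N : Fin (suc s)) → Any P (rulesOfSize≤ k (toℕ N) s)
  from (record { #N = N ; rules = R ; start = S ; acyclic = ac } , e , z) =
    Fin.fromℕ< N<1+s ,
    subst (λ n → Any P (rulesOfSize≤ k n s)) (sym (Fin.toℕ-fromℕ< N<1+s))
      (lose (∈-rulesOfSize≤ R (ℕ.≤-reflexive z)) (ac , S , e , z))
    where
    N<1+s : N ℕ.< suc s
    N<1+s = s≤s (ℕ.≤-trans (N≤size R) (ℕ.≤-reflexive z))

trivialSLP : Word k → SLP k
trivialSLP w = record
  { rules   = List⁺.map inj₂ w ∷ []
  ; start   = zero
  ; acyclic = rank⇒acyclic (List⁺.map inj₂ w ∷ []) (λ _ → 0) λ { {zero} u → ⊥-elim (no-uses (List⁺.toList w) u) }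
  }
  where
  no-uses : ∀ {k} {B : Fin 1} (u : List (Fin k)) → ¬ (inj₁ B ∈ List.map inj₂ u)
  no-uses (_ ∷ u) (there p) = no-uses u p

val-trivialSLP : (w : Word k) → val (trivialSLP w) ≡ List⁺.toList w
val-trivialSLP w = val-unique (trivialSLP w) (rule (go (List⁺.toList w)))
  where
  go : ∀ u → SLP.rules (trivialSLP w) ⊢ List.map inj₂ u ⇒* u
  go []      = []
  go (_ ∷ u) = term ∷ go u

-- Opaque because unfolding the search makes type checking very slow.
opaque
  smallest : (w : Word k) → ∃ (IsMinimum (HasSLPOfSize w))
  smallest w = minimum (hasSLPOfSize? w) _ (trivialSLP w , val-trivialSLP w , refl)

g : Word k → ℕ
g w = proj₁ (smallest w)

size-nonZero : (𝔸 : SLP k) → NonZero (size 𝔸)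
size-nonZero 𝔸 with SLP.#N 𝔸 | SLP.rules 𝔸 | SLP.start 𝔸
... | suc _ | (_ ∷ _) ∷ _ | _ = _

instance
  g-nonZero : {w : Word k} → NonZero (g w)
  g-nonZero {w = w} =
    let (𝔸 , _ , e) , _ = proj₂ (smallest w) in subst NonZero e (size-nonZero 𝔸)

record Compressor : Set where
  field
    compress : Word k → SLP k
    correct  : (w : Word k) → val (compress w) ≡ List⁺.toList w

open Compressor public

words : (k n : ℕ) → List (Word k)
words k zero    = []
words k (suc n) = List.map List⁺.fromVec (vecs (List.allFin k) (suc n))

ratio : Compressor → Word k → ℚ
ratio 𝒞 w = (+ size (compress 𝒞 w)) / g w

-- All ratios are positive, so the default value 0 only matters when there is
-- no nonempty word of length n over [1,k], i.e. for k = 0 or n = 0.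
α : Compressor → ℕ → ℕ → ℚ
α 𝒞 k n = max 0ℚ (List.map (ratio 𝒞) (words k n))
  where open Data.List.Extrema (DecTotalOrder.totalOrder ℚ.≤-decTotalOrder) using (max)

-- With m = ℓ - 1: f enumerates f₀, …, f_{ℓ-1}, and f_ℓ = f last.
record Factorization {k : ℕ} (w : List (Fin k)) : Set where
  field
    {m}      : ℕ
    f        : Fin (suc m) → List (Fin k)
    last     : Fin (suc m)
    f₀       : f zero ≡ []
    distinct : ∀ {i j} → f i ≡ f j → i ≡ j
    extends  : (i : Fin m) → ∃₂ λ j a → j Fin.< suc i × f (suc i) ≡ f j ++ List.[ a ]
    factors  : concat (tabulate (f ∘ suc)) ++ f last ≡ w

-- Appending one letter to the input either lengthens the last factor to
-- another known factor or completes a new factor, leaving f_ℓ = ε.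

snoc : {A : Set} {m : ℕ} → (Fin m → A) → A → Fin (suc m) → A
snoc {m = zero}  f x zero    = x
snoc {m = suc m} f x zero    = f zero
snoc {m = suc m} f x (suc i) = snoc (f ∘ suc) x i

snoc-inject₁ : {A : Set} {m : ℕ} (f : Fin m → A) (x : A) →
               ∀ i → snoc f x (inject₁ i) ≡ f i
snoc-inject₁ f x zero    = refl
snoc-inject₁ f x (suc i) = snoc-inject₁ (f ∘ suc) x i

snoc-fromℕ : {A : Set} {m : ℕ} (f : Fin m → A) (x : A) → snoc f x (fromℕ m) ≡ x
snoc-fromℕ {m = zero}  f x = refl
snoc-fromℕ {m = suc m} f x = snoc-fromℕ (f ∘ suc) x

concat-snoc : {A : Set} {m : ℕ} (f : Fin m → List A) (x : List A) →
              concat (tabulate (snoc f x)) ≡ concat (tabulate f) ++ x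
concat-snoc {m = zero}  f x = List.++-identityʳ x
concat-snoc {m = suc m} f x =
  trans (cong (f zero ++_) (concat-snoc (f ∘ suc) x)) (sym (List.++-assoc (f zero) _ x))

emptyFactorization : Factorization {k} []
emptyFactorization = record
  { m        = 0
  ; f        = λ _ → []
  ; last     = zero
  ; f₀       = refl
  ; distinct = λ { {zero} {zero} _ → refl }
  ; extends  = λ ()
  ; factors  = refl
  }

read : {w : List (Fin k)} → Factorization w → (a : Fin k) → Factorization (w ++ List.[ a ])
read {k} {w} F a with (let open Factorization F in
  Fin.any? λ j → List.≡-dec Fin._≟_ (f j) (f last ++ List.[ a ]))
... | yes (j , fj≡) = record
  { f        = f
  ; last     = j
  ; f₀       = f₀
  ; distinct = distinct
  ; extends  = extends
  ; factors  = begin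
      concat (tabulate (f ∘ suc)) ++ f j                    ≡⟨ cong (concat (tabulate (f ∘ suc)) ++_) fj≡ ⟩
      concat (tabulate (f ∘ suc)) ++ f last ++ List.[ a ]   ≡⟨ List.++-assoc (concat (tabulate (f ∘ suc))) (f last) _ ⟨
      (concat (tabulate (f ∘ suc)) ++ f last) ++ List.[ a ] ≡⟨ cong (_++ _) factors ⟩
      w ++ List.[ a ]                                       ∎
  }
  where open Factorization F
        open ≡-Reasoning
... | no new = record
  { f        = f′
  ; last     = zero
  ; f₀       = f₀
  ; distinct = distinct′ _ _
  ; extends  = extends′
  ; factors  = begin
      concat (tabulate (f′ ∘ suc)) ++ f zero                ≡⟨ cong (concat (tabulate (f′ ∘ suc)) ++_) f₀ ⟩
      concat (tabulate (f′ ∘ suc)) ++ []                    ≡⟨ List.++-identityʳ _ ⟩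
      concat (tabulate (f′ ∘ suc))                          ≡⟨ concat-snoc (f ∘ suc) x ⟩
      concat (tabulate (f ∘ suc)) ++ f last ++ List.[ a ]   ≡⟨ List.++-assoc (concat (tabulate (f ∘ suc))) (f last) _ ⟨
      (concat (tabulate (f ∘ suc)) ++ f last) ++ List.[ a ] ≡⟨ cong (_++ _) factors ⟩
      w ++ List.[ a ]                                       ∎
  }
  where
  open Factorization F
  open ≡-Reasoning
  x : List (Fin k)
  x = f last ++ List.[ a ]
  f′ : Fin (suc (suc m)) → List (Fin k)
  f′ = snoc f x

  old : ∀ i → f′ (inject₁ i) ≡ f i
  old = snoc-inject₁ f x
  top : f′ (fromℕ (suc m)) ≡ x
  top = snoc-fromℕ f x

  distinct′ : ∀ i j → f′ i ≡ f′ j → i ≡ j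
  distinct′ i j e with view i | view j
  ... | ‵fromℕ         | ‵fromℕ         = refl
  ... | ‵fromℕ         | ‵inj₁ {i = j} _ = ⊥-elim (new (j , trans (sym (old j)) (trans (sym e) top)))
  ... | ‵inj₁ {i = i} _ | ‵fromℕ         = ⊥-elim (new (i , trans (sym (old i)) (trans e top)))
  ... | ‵inj₁ {i = i} _ | ‵inj₁ {i = j} _ =
        cong inject₁ (distinct (trans (sym (old i)) (trans e (old j))))

  extends′ : (i : Fin (suc m)) → ∃₂ λ j b → j Fin.< suc i × f′ (suc i) ≡ f′ j ++ List.[ b ]
  extends′ i with view i
  ... | ‵fromℕ = inject₁ last , a ,
        s≤s (subst₂ ℕ._≤_ (sym (Fin.toℕ-inject₁ last)) (sym (Fin.toℕ-fromℕ m)) (Fin.toℕ≤pred[n] last)) ,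
        trans top (cong (_++ List.[ a ]) (sym (old last)))
  ... | ‵inj₁ {i = i} _ with extends i
  ...   | j , b , j≤i , e = inject₁ j , b ,
        subst₂ (λ x y → x ℕ.< suc y) (sym (Fin.toℕ-inject₁ j)) (sym (Fin.toℕ-inject₁ i)) j≤i ,
        trans (old (suc i)) (trans e (cong (_++ List.[ b ]) (sym (old j))))

factorize : (w : List (Fin k)) → Factorization w
factorize w = go emptyFactorization w
  where
  go : ∀ {k} {u : List (Fin k)} → Factorization u → ∀ v → Factorization (u ++ v)
  go {u = u} F []      = subst Factorization (sym (List.++-identityʳ u)) F
  go {u = u} F (a ∷ v) = subst Factorization (List.++-assoc u _ v) (go (read F a) v)

-- Nonterminal 0 is the start symbol S, nonterminal i ≥ 1 is F_i; so an index
-- j of a factor denotes F_j when j ≥ 1 and the empty word when j = 0.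
factor : {m : ℕ} → Fin (suc m) → List (Symbol k (suc m))
factor zero    = []
factor (suc j) = List.[ inj₁ (suc j) ]

module _ {k : ℕ} {w : List (Fin k)} (w≢[] : w ≢ []) (F : Factorization w) where
  open Factorization F

  startBody : List (Symbol k (suc m))
  startBody = tabulate (inj₁ ∘ suc) ++ factor last

  startBody≢[] : startBody ≢ []
  startBody≢[] e = w≢[] (trans (sym factors) (empty f f₀ last e))
    where
    empty : ∀ {n} (f : Fin (suc n) → List (Fin k)) → f zero ≡ [] → ∀ l →
            tabulate (inj₁ ∘ suc) ++ factor {k} l ≡ [] →
            concat (tabulate (f ∘ suc)) ++ f l ≡ []
    empty {zero}  f f₀ zero e  = f₀
    empty {suc n} f f₀ l    ()

  toList⁺ : ∀ {A : Set} (xs : List A) → xs ≢ [] → List⁺ A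
  toList⁺ []       ne = ⊥-elim (ne refl)
  toList⁺ (x ∷ xs) _  = x ∷ xs

  toList-toList⁺ : ∀ {A : Set} (xs : List A) (ne : xs ≢ []) → List⁺.toList (toList⁺ xs ne) ≡ xs
  toList-toList⁺ []       ne = ⊥-elim (ne refl)
  toList-toList⁺ (x ∷ xs) _  = refl

  factorBody : Fin m → List⁺ (Symbol k (suc m))
  factorBody i = let j , a , _ = extends i in factor j List⁺.++⁺ (inj₂ a ∷ [])

  lz78Rules : Rules k (suc m)
  lz78Rules = toList⁺ startBody startBody≢[] ∷ Vec.tabulate factorBody

  rhs-start : rhs lz78Rules zero ≡ startBody
  rhs-start = toList-toList⁺ startBody startBody≢[]

  rhs-factor : ∀ i → let j , a , _ = extends i in
               rhs lz78Rules (suc i) ≡ factor j ++ List.[ inj₂ a ]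
  rhs-factor i with eq ← Vec.lookup∘tabulate factorBody i | extends i
  ... | zero  , _ = cong List⁺.toList eq
  ... | suc j , _ = cong List⁺.toList eq

  rank : Fin (suc m) → ℕ
  rank zero    = suc m
  rank (suc i) = suc (toℕ i)

  factor-uses : ∀ {B} j → inj₁ B ∈ factor {k} {m} j → B ≡ j × ∃ λ i → B ≡ suc i
  factor-uses (suc j) (here refl) = refl , j , refl

  rank-decreases : ∀ A {B} → Uses lz78Rules A B → rank B ℕ.< rank A
  rank-decreases zero {B} u
    with ∈-++⁻ (tabulate (inj₁ ∘ suc)) (subst (inj₁ B ∈_) rhs-start u)
  ... | inj₁ u′ with ∈-tabulate⁻ u′
  ...   | i , refl = s≤s (Fin.toℕ<n i)
  rank-decreases zero u | inj₂ u′ with factor-uses last u′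
  ...   | _ , i , refl = s≤s (Fin.toℕ<n i)
  rank-decreases (suc i) {B} u with extends i | subst (inj₁ B ∈_) (rhs-factor i) u
  ... | j , a , j<i , _ | u′ with ∈-++⁻ (factor j) u′
  ...   | inj₂ (here ())
  ...   | inj₁ u″ with factor-uses j u″
  ...     | refl , _ , refl = j<i

  lz78SLP : SLP k
  lz78SLP = record
    { rules   = lz78Rules
    ; start   = zero
    ; acyclic = rank⇒acyclic lz78Rules rank (rank-decreases _)
    }

  derive-factor : ∀ j → (∀ i → j ≡ suc i → lz78Rules ⊢ inj₁ (suc i) ⇒ f (suc i)) →
                  lz78Rules ⊢ factor j ⇒* f j
  derive-factor zero    _ = subst (lz78Rules ⊢ [] ⇒*_) (sym f₀) []
  derive-factor (suc i) d =
    subst (lz78Rules ⊢ _ ⇒*_) (List.++-identityʳ _) (d i refl ∷ [])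

  derive-F : ∀ n i → toℕ i ≡ n → lz78Rules ⊢ inj₁ (suc i) ⇒ f (suc i)
  derive-F = <-rec _ λ n rec i i≡n →
    let j , a , j<i , e = extends i in
    rule (subst₂ (lz78Rules ⊢_⇒*_) (sym (rhs-factor i)) (sym e)
      (⇒*-++ (derive-factor j λ i′ j≡ →
                rec (subst₂ ℕ._≤_ (cong toℕ j≡) i≡n (ℕ.s≤s⁻¹ j<i)) i′ refl)
             (term ∷ [])))

  val-lz78SLP : val lz78SLP ≡ w
  val-lz78SLP = val-unique lz78SLP (rule
    (subst₂ (lz78Rules ⊢_⇒*_) (sym rhs-start) factors
      (⇒*-++ (all suc (λ i → derive-F _ i refl))
             (derive-factor last λ i _ → derive-F _ i refl))))
    where
    all : ∀ {n} (h : Fin n → Fin (suc m)) → (∀ i → lz78Rules ⊢ inj₁ (h i) ⇒ f (h i)) →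
          lz78Rules ⊢ tabulate (inj₁ ∘ h) ⇒* concat (tabulate (f ∘ h))
    all {zero}  h d = []
    all {suc n} h d = d zero ∷ all (h ∘ suc) (d ∘ suc)

LZ78 : Compressor
LZ78 = record
  { compress = λ w → lz78SLP (λ ()) (factorize (List⁺.toList w))
  ; correct  = λ w → val-lz78SLP (λ ()) (factorize (List⁺.toList w))
  }

-- A real number, given by the rationals strictly below and strictly above it.
record Cut : Set₁ where
  field
    below above : ℚ → Set

open Cut public

-- For r = p/q ≥ 0 and n ≥ 1:  r < log₂ n  iff  2^p < n^q.
log₂ : ℕ → Cut
log₂ n = record
  { below = λ r → r ℚ.< 0ℚ ⊎ 2 ℕ.^ ∣ ↥ r ∣ ℕ.< n ℕ.^ ↧ₙ r
  ; above = λ r → 0ℚ ℚ.≤ r × n ℕ.^ ↧ₙ r ℕ.< 2 ℕ.^ ∣ ↥ r ∣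
  }

-- For n ≥ 2:  q < (n / log₂ n)^(2/3)  iff  q³ (log₂ n)² < n², which holds iff
-- q³ r² < n² for some rational r > log₂ n; dually for >.  For q ≤ 0 the
-- condition in below is always satisfied, that in above never.
[_/log]^⅔ : ℕ → Cut
[ n /log]^⅔ = record
  { below = λ q → ∃[ r ] above (log₂ n) r ×
              (q ℚ.* q ℚ.* q) ℚ.* (r ℚ.* r) ℚ.< n′ ℚ.* n′
  ; above = λ q → ∃[ r ] 0ℚ ℚ.≤ r × below (log₂ n) r ×
              n′ ℚ.* n′ ℚ.< (q ℚ.* q ℚ.* q) ℚ.* (r ℚ.* r)
  }
  where n′ = + n / 1

-- Only meaningful for c > 0.

infix 4 _·_≤ᶜ_ _≤ᶜ_·_

_·_≤ᶜ_ : ℚ → Cut → ℚ → Set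
c · x ≤ᶜ a = ∀ q → below x q → c ℚ.* q ℚ.≤ a

_≤ᶜ_·_ : ℚ → ℚ → Cut → Set
a ≤ᶜ c · x = ∀ q → above x q → a ℚ.≤ c ℚ.* q

{-# OPTIONS --safe #-}

-- Upper bound.  Let the LZ78 parse of a word of length n have m factors, and let
-- g be the size of a smallest grammar.  A word generated by a grammar of size g
-- has at most g κ² distinct nonempty subwords of length at most κ, so for
-- 2 g κ² ≤ m < 2 g (κ + 1)² at least half of the m distinct factors are longer
-- than κ.  Hence m (κ + 1) ≤ 2 n and m³ ≤ 8 g n², and log₂ n ≤ g.
--
-- Lower bound.  With u = ∏_{t ≤ q} a²ᴸ bᵗ aᴸ bᵗ and y = a²ᴸ b^{q+1} a²ᴸ, LZ78 parses
-- a¹ a² ⋯ a²ᴸ (uᴸ y)ᴸ as follows: in the j-th copy of u within the ρ-th copy of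
-- uᴸ y (0 ≤ ρ, j < L) the factors are a^{2L-ρ} bᵗ aʲ and a^{L-j} bᵗ a^ρ for
-- t = 1, …, q.  The first ones fill a table row by row and the second ones fill
-- another table column by column, so all these factors are new and each extends an
-- earlier one.  In y the factors are a^{2L-ρ} b^{q+1} and a^{2L+1+ρ}; the second
-- grows with ρ and thereby shifts the next round by one letter.  This gives
-- 2 q L² factors in a text of length O(q L³) which, for q = ⌊log₂ n⌋, has a
-- grammar of size O(q).
module Submission where

open import Defs
open import Data.Fin as Fin using (Fin; zero; suc; toℕ)
import Data.Fin.Properties as Fin
import Data.Integer as ℤ
import Data.Integer.Properties as ℤ
open import Data.List as List using (List; []; _∷_; _++_; length; concat; replicate; tabulate; take; drop)
import Data.List.Extrema
open import Data.List.Membership.Propositional using (_∈_; _∉_; lose)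
open import Data.List.Membership.Propositional.Properties
  using (∈-lookup; ∈-concat⁺′; ∈-tabulate⁺; ∈-tabulate⁻; ∈-filter⁻; ∈-++⁺ˡ; ∈-++⁺ʳ; ∈-++⁻;
         ∈-map⁺; ∈-map⁻; ∈-allFin; ∈-cartesianProductWith⁺; ∈-upTo⁺)
open import Data.List.NonEmpty as List⁺ using (List⁺; _∷_)
import Data.List.Properties as List
open import Data.List.Relation.Unary.All as All using (All; []; _∷_)
import Data.List.Relation.Unary.All.Properties as All
open import Data.List.Relation.Unary.AllPairs using ([]; _∷_)
open import Data.List.Relation.Unary.Any using (index; here; there)
open import Data.List.Relation.Unary.Any.Properties using (lookup-index)
open import Data.List.Relation.Unary.Unique.Propositional using (Unique)
open import Data.List.Relation.Unary.Unique.Propositional.Properties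
  using (++⁺; filter⁺; map⁺; tabulate⁺)
import Data.Nat as ℕ
import Data.Nat.Coprimality as Coprimality
import Data.Nat.Properties as ℕ
open import Data.Nat.Tactic.RingSolver using (solve-∀)
open import Data.Product using (∃; ∃₂; ∃-syntax; _×_; _,_; proj₁; proj₂)
import Data.Rational.Properties as ℚ
open import Data.Rational.Solver using (module +-*-Solver)
open import Data.Rational.Unnormalised as ℚᵘ using (mkℚᵘ; *≡*)
import Data.Rational.Unnormalised.Properties as ℚᵘ
open import Data.Sum as Sum using (_⊎_; inj₁; inj₂)
open import Data.Vec as Vec using (Vec; []; _∷_)
import Data.Vec.Properties as Vec
import Data.Vec.Relation.Unary.All as VecAll
open import Function using (_∘_)
open import Relation.Binary.Bundles using (DecTotalOrder)
open import Relation.Binary.PropositionalEquality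
open import Relation.Nullary using (¬_; Dec; yes; no; contradiction)

-- Dividing m³ ≤ 8 g n² by g³ shows where the exponent 2/3 comes from: the cube of the ratio is at
-- most of order (n / g)², and g is at least log₂ n. A matching text therefore needs a grammar of
-- size O(log n) and about L² log n factors whose average length is of order L. So it has to be
-- almost periodic, while the parse must never treat two copies of the period alike. The solution is
-- to let factor boundaries cut runs of a at moving positions: each factor borrows letters from the
-- run that the next factor continues, so the counters ρ and j show up in the factors but cancel in
-- the text. A grammar of size O(log n) can afford to spell out q = ⌊log₂ n⌋ different runs of b;
-- they multiply the number of factors by q, which cancels the q in the grammar size, and the ratio
-- is left with order L², that is (n / q)^(2/3). Both bounds are uniform in k: two letters suffice
-- for the text, and the count of subwords does not see the alphabet. Roots and logarithms are
-- present only as rational cuts, so all comparisons are made between cubes and squares.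

module Combinatorics where
  open import Data.Nat using (ℕ; zero; suc; pred; _+_; _*_; _∸_; _^_; _≤_; _<_; z≤n; s≤s; _≤?_; _<?_)
  open import Data.Nat.Properties

  private variable
    k N : ℕ

  -- Grammars: length of the value and number of short subwords

  total : ∀ {n} → (Fin n → ℕ) → ℕ
  total {zero}  f = 0
  total {suc n} f = f zero + total (f ∘ suc)

  total-mono : ∀ {n} {f h : Fin n → ℕ} → (∀ i → f i ≤ h i) → total f ≤ total h
  total-mono {zero}  le = z≤n
  total-mono {suc n} le = +-mono-≤ (le zero) (total-mono (le ∘ suc))

  total-gap : ∀ {n} {f h : Fin n → ℕ} {r} i → (∀ j → f j ≤ h j) → r + f i ≤ h i →
              r + total f ≤ total h
  total-gap {suc n} {f} {h} {r} zero le gap = begin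
    r + (f zero + total (f ∘ suc)) ≡⟨ +-assoc r (f zero) _ ⟨
    r + f zero + total (f ∘ suc)   ≤⟨ +-mono-≤ gap (total-mono (le ∘ suc)) ⟩
    h zero + total (h ∘ suc)       ∎
    where open ≤-Reasoning
  total-gap {suc n} {f} {h} {r} (suc i) le gap = begin
    r + (f zero + total (f ∘ suc)) ≡⟨ +-assoc r (f zero) _ ⟨
    r + f zero + total (f ∘ suc)   ≡⟨ cong (_+ total (f ∘ suc)) (+-comm r (f zero)) ⟩
    f zero + r + total (f ∘ suc)   ≡⟨ +-assoc (f zero) r _ ⟩
    f zero + (r + total (f ∘ suc)) ≤⟨ +-mono-≤ (le zero) (total-gap i (le ∘ suc) gap) ⟩
    h zero + total (h ∘ suc)       ∎
    where open ≤-Reasoning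

  total-*ʳ : ∀ {n} (f : Fin n → ℕ) c → total (λ i → f i * c) ≡ total f * c
  total-*ʳ {zero}  f c = refl
  total-*ʳ {suc n} f c = trans (cong (f zero * c +_) (total-*ʳ (f ∘ suc) c)) (sym (*-distribʳ-+ c (f zero) _))

  sum-map : ∀ {A : Set} {n} (h : A → ℕ) (xs : Vec A n) →
            Vec.sum (Vec.map h xs) ≡ total (h ∘ Vec.lookup xs)
  sum-map h []       = refl
  sum-map h (x ∷ xs) = cong (h x +_) (sum-map h xs)

  length-concat-tabulate : ∀ {A : Set} {n} (f : Fin n → List A) →
                           length (concat (tabulate f)) ≡ total (length ∘ f)
  length-concat-tabulate {n = zero}  f = refl
  length-concat-tabulate {n = suc n} f =
    trans (List.length-++ (f zero)) (cong (length (f zero) +_) (length-concat-tabulate (f ∘ suc)))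

  length-cartesianProductWith : ∀ {A B C : Set} (f : A → B → C) xs ys →
    length (List.cartesianProductWith f xs ys) ≡ length xs * length ys
  length-cartesianProductWith f []       ys = refl
  length-cartesianProductWith f (x ∷ xs) ys = trans (List.length-++ (List.map (f x) ys))
    (cong₂ _+_ (List.length-map (f x) ys) (length-cartesianProductWith f xs ys))

  take-length-++ : ∀ {A : Set} (xs : List A) {ys} → take (length xs) (xs ++ ys) ≡ xs
  take-length-++ []       = refl
  take-length-++ (x ∷ xs) = cong (x ∷_) (take-length-++ xs)

  drop-length-++ : ∀ {A : Set} (xs : List A) {ys} → drop (length xs) (xs ++ ys) ≡ ys
  drop-length-++ []       = refl
  drop-length-++ (x ∷ xs) = drop-length-++ xs

  n≤2^n : ∀ n → n ≤ 2 ^ n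
  n≤2^n zero    = z≤n
  n≤2^n (suc n) = begin
    1 + n             ≤⟨ +-mono-≤ (m^n>0 2 n) (n≤2^n n) ⟩
    2 ^ n + 2 ^ n     ≡⟨ cong (2 ^ n +_) (+-identityʳ _) ⟨
    2 ^ suc n         ∎
    where open ≤-Reasoning

  module _ {R : Rules k N} (v : Fin N → List (Fin k)) (v-derived : ∀ A → R ⊢ inj₁ A ⇒ v A) where

    mutual
      ⇒-nonempty : ∀ {s u} → R ⊢ s ⇒ u → 1 ≤ length u
      ⇒-nonempty term         = s≤s z≤n
      ⇒-nonempty (rule {A} d) = ≤-trans (s≤s z≤n) (⇒*-nonempty d)

      ⇒*-nonempty : ∀ {ss u} → R ⊢ ss ⇒* u → length ss ≤ length u
      ⇒*-nonempty []       = z≤n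
      ⇒*-nonempty (_∷_ {u = u} d ds) =
        ≤-trans (+-mono-≤ (⇒-nonempty d) (⇒*-nonempty ds)) (≤-reflexive (sym (List.length-++ u)))

    arity : Fin N → ℕ
    arity A = List⁺.length (Vec.lookup R A)

    -- A nonterminal may occur many times in a derivation tree, and a plain induction on the tree
    -- would count its rule each time. With the threshold `T` every rule enters the sum once, when
    -- `T` reaches the length of its value.
    arity≤ : ℕ → Fin N → ℕ
    arity≤ T A with length (v A) ≤? T
    ... | yes _ = arity A
    ... | no  _ = 0

    weight : ℕ → ℕ
    weight T = total (arity≤ T)

    arity≤-mono : ∀ {T U} → T ≤ U → ∀ A → arity≤ T A ≤ arity≤ U A
    arity≤-mono {T} {U} T≤U A with length (v A) ≤? T | length (v A) ≤? U
    ... | yes _ | yes _ = ≤-refl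
    ... | yes p | no ¬q = contradiction (≤-trans p T≤U) ¬q
    ... | no  _ | _     = z≤n

    weight≤ : ∀ T → weight T ≤ Vec.sum (Vec.map List⁺.length R)
    weight≤ T = ≤-trans (total-mono bound) (≤-reflexive (sym (sum-map List⁺.length R)))
      where
      bound : ∀ A → arity≤ T A ≤ arity A
      bound A with length (v A) ≤? T
      ... | yes _ = ≤-refl
      ... | no  _ = z≤n

    weight-gap : ∀ {T} A → length (v A) ≡ suc T → arity A + weight T ≤ weight (suc T)
    weight-gap {T} A e = total-gap A (arity≤-mono (n≤1+n T)) gap
      where
      gap : arity A + arity≤ T A ≤ arity≤ (suc T) A
      gap with length (v A) ≤? T | length (v A) ≤? suc T
      ... | yes p | _     = contradiction (≤-trans (≤-reflexive (sym e)) p) 1+n≰n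
      ... | no  _ | yes _ = ≤-reflexive (+-identityʳ _)
      ... | no  _ | no ¬q = contradiction (≤-reflexive e) ¬q

    mutual
      -- A rule with a single symbol changes neither the value nor the weight; in any
      -- other rule the symbols have shorter values, so the rule itself is not counted yet.
      length≤2^weight : ∀ {s u} → R ⊢ s ⇒ u → length u ≤ 2 ^ weight (length u)
      length≤2^weight (term {a}) = m^n>0 2 (weight 1)
      length≤2^weight (rule {A} {u} d) = go (rhs R A) refl d
        where
        go : ∀ ss → rhs R A ≡ ss → R ⊢ ss ⇒* u → length u ≤ 2 ^ weight (length u)
        go (s ∷ []) e (_∷_ {u = u₁} d₁ []) =
          subst (λ w → length w ≤ 2 ^ weight (length w)) (sym (List.++-identityʳ u₁)) (length≤2^weight d₁)
        go ss@(_ ∷ _ ∷ _) e ds = bound (length u) refl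
          where
          open ≤-Reasoning
          bound : ∀ l → length u ≡ l → l ≤ 2 ^ weight l
          bound zero    _  = z≤n
          bound (suc T) eq = begin
            suc T                        ≡⟨ eq ⟨
            length u
              ≤⟨ length≤*2^weight ds T (≤-trans (≤-reflexive (cong suc eq))
                  (≤-trans (≤-reflexive (+-comm 2 T)) (+-monoʳ-≤ T (s≤s (s≤s z≤n))))) ⟩
            length ss * 2 ^ weight T     ≤⟨ *-monoˡ-≤ (2 ^ weight T) (n≤2^n (length ss)) ⟩
            2 ^ length ss * 2 ^ weight T ≡⟨ ^-distribˡ-+-* 2 (length ss) (weight T) ⟨
            2 ^ (length ss + weight T)   ≡⟨ cong (λ r → 2 ^ (length r + weight T)) e ⟨
            2 ^ (arity A + weight T)
              ≤⟨ ^-monoʳ-≤ 2 (weight-gap A (trans (cong length (⇒-unique (v-derived A) (rule d))) eq)) ⟩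
            2 ^ weight (suc T)           ∎

      -- Every other symbol contributes at least one letter, so the hypothesis keeps each single
      -- value within length `T`. It is inherited by the remaining symbols when the first one is
      -- removed.
      length≤*2^weight : ∀ {ss u} → R ⊢ ss ⇒* u → ∀ T → suc (length u) ≤ T + length ss →
                         length u ≤ length ss * 2 ^ weight T
      length≤*2^weight [] T _ = z≤n
      length≤*2^weight {s ∷ ss} (_∷_ {u = u₁} {u₂} d ds) T le = begin
        length (u₁ ++ u₂)                     ≡⟨ List.length-++ u₁ ⟩
        length u₁ + length u₂
          ≤⟨ +-mono-≤ (≤-trans (length≤2^weight d) (^-monoʳ-≤ 2 (total-mono (arity≤-mono u₁≤T))))
                                                          (length≤*2^weight ds T u₂≤) ⟩
        2 ^ weight T + length ss * 2 ^ weight T ∎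
        where
        open ≤-Reasoning
        le′ : length u₁ + length u₂ ≤ T + length ss
        le′ = ≤-pred (≤-trans (≤-reflexive (cong suc (sym (List.length-++ u₁))))
            (≤-trans le (≤-reflexive (+-suc T (length ss)))))
        u₁≤T : length u₁ ≤ T
        u₁≤T = +-cancelʳ-≤ (length ss) _ _ (≤-trans (+-monoʳ-≤ (length u₁) (⇒*-nonempty ds)) le′)
        u₂≤ : suc (length u₂) ≤ T + length ss
        u₂≤ = ≤-trans (+-monoˡ-≤ (length u₂) (⇒-nonempty d)) le′

  module _ (𝔸 : SLP k) where
    open SLP 𝔸 hiding (size)

    private
      v : Fin #N → List (Fin k)
      v A = proj₁ (derive rules acyclic A)
      v-derived : ∀ A → rules ⊢ inj₁ A ⇒ v A
      v-derived A = proj₂ (derive rules acyclic A)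

    length-val : length (val 𝔸) ≤ 2 ^ size 𝔸
    length-val = ≤-trans (length≤2^weight v v-derived (v-derived start))
                         (^-monoʳ-≤ 2 (weight≤ v v-derived (length (val 𝔸))))

    value : Symbol k #N → List (Fin k)
    value (inj₁ A) = v A
    value (inj₂ a) = List.[ a ]

    values : List (Symbol k #N) → List (Fin k)
    values []       = []
    values (s ∷ ss) = value s ++ values ss

    value-unique : ∀ {s u} → rules ⊢ s ⇒ u → u ≡ value s
    value-unique {inj₁ A} d    = ⇒-unique d (v-derived A)
    value-unique          term = refl

    values-unique : ∀ {ss u} → rules ⊢ ss ⇒* u → u ≡ values ss
    values-unique []       = refl
    values-unique (d ∷ ds) = cong₂ _++_ (value-unique d) (values-unique ds)

    module _ (κ : ℕ) where

      -- The words of length at most κ that begin in the last κ letters of value s.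
      windows : Symbol k #N → List (Symbol k #N) → List (List (Fin k))
      windows s ss = List.cartesianProductWith
        (λ d j → take (suc j) (drop (length (value s) ∸ suc d) (value s ++ values ss)))
        (List.upTo κ) (List.upTo κ)

      allWindows : List (Symbol k #N) → List (List (Fin k))
      allWindows []       = []
      allWindows (s ∷ ss) = windows s ss ++ allWindows ss

      candidates : List (List (Fin k))
      candidates = concat (tabulate (allWindows ∘ rhs rules))

      length-allWindows : ∀ ss → length (allWindows ss) ≡ length ss * (κ * κ)
      length-allWindows []       = refl
      length-allWindows (s ∷ ss) = trans (List.length-++ (windows s ss))
        (cong₂ _+_ (trans (length-cartesianProductWith _ (List.upTo κ) (List.upTo κ))
                          (cong₂ _*_ (List.length-upTo κ) (List.length-upTo κ)))
                   (length-allWindows ss))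

      length-candidates : length candidates ≡ size 𝔸 * (κ * κ)
      length-candidates = begin
        length candidates
          ≡⟨ length-concat-tabulate (allWindows ∘ rhs rules) ⟩
        total (length ∘ allWindows ∘ rhs rules)
          ≡⟨ total-cong (λ A → length-allWindows (rhs rules A)) ⟩
        total (λ A → List⁺.length (Vec.lookup rules A) * (κ * κ))
          ≡⟨ total-*ʳ (List⁺.length ∘ Vec.lookup rules) (κ * κ) ⟩
        total (λ A → List⁺.length (Vec.lookup rules A)) * (κ * κ)
          ≡⟨ cong (_* (κ * κ)) (sum-map List⁺.length rules) ⟨
        size 𝔸 * (κ * κ)                                    ∎
        where
        open ≡-Reasoning
        total-cong : ∀ {n} {f h : Fin n → ℕ} → (∀ i → f i ≡ h i) → total f ≡ total h
        total-cong e = ≤-antisym (total-mono (≤-reflexive ∘ e)) (total-mono (≤-reflexive ∘ sym ∘ e))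

      module _ {x : List (Fin k)} (x≢[] : 1 ≤ length x) (x≤κ : length x ≤ κ) where

        Infix : List (Fin k) → Set
        Infix u = ∃₂ λ p q → p ++ x ++ q ≡ u

        crossing : ∀ {p r q} s ss → 1 ≤ length r → length r ≤ length x →
                   p ++ r ≡ value s → p ++ x ++ q ≡ value s ++ values ss → x ∈ windows s ss
        crossing {p} {r} {q} s ss r≢[] r≤x e e′ with length r in er | length x in ex
        ... | suc d | suc j = subst (_∈ windows s ss) window
                (∈-cartesianProductWith⁺ _ (∈-upTo⁺ (≤-trans r≤x x≤κ)) (∈-upTo⁺ x≤κ))
          where
          open ≡-Reasoning
          drop-length : length (value s) ∸ suc d ≡ length p
          drop-length = begin
            length (value s) ∸ suc d     ≡⟨ cong (λ u → length u ∸ suc d) e ⟨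
            length (p ++ r) ∸ suc d      ≡⟨ cong (_∸ suc d) (List.length-++ p) ⟩
            length p + length r ∸ suc d  ≡⟨ cong (λ l → length p + l ∸ suc d) er ⟩
            length p + suc d ∸ suc d     ≡⟨ m+n∸n≡m (length p) (suc d) ⟩
            length p                     ∎
          window : take (suc j) (drop (length (value s) ∸ suc d) (value s ++ values ss)) ≡ x
          window = begin
            take (suc j) (drop (length (value s) ∸ suc d) (value s ++ values ss))
              ≡⟨ cong₂ (λ l u → take (suc j) (drop l u)) drop-length (sym e′) ⟩
            take (suc j) (drop (length p) (p ++ x ++ q))
              ≡⟨ cong₂ take (sym ex) (drop-length-++ p) ⟩
            take (length x) (x ++ q)                                             ≡⟨ take-length-++ x ⟩
            x                                                                    ∎

        ++-split : ∀ (p : List (Fin k)) {y} u₁ {u₂} → p ++ y ≡ u₁ ++ u₂ →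
                   (∃ λ p′ → p′ ++ y ≡ u₂) ⊎ (∃ λ r → 1 ≤ length r × p ++ r ≡ u₁ × y ≡ r ++ u₂)
        ++-split p        []       e = inj₁ (p , e)
        ++-split []       (a ∷ u₁) e = inj₂ (a ∷ u₁ , s≤s z≤n , refl , e)
        ++-split (b ∷ p)  (a ∷ u₁) e with List.∷-injective e
        ... | refl , e′ with ++-split p u₁ e′
        ...   | inj₁ found              = inj₁ found
        ...   | inj₂ (r , r≢[] , e₁ , e₂) = inj₂ (r , r≢[] , cong (b ∷_) e₁ , e₂)

        ++-prefix : ∀ (y : List (Fin k)) {q} r {t} → y ++ q ≡ r ++ t → length y ≤ length r →
                    ∃ λ z → y ++ z ≡ r
        ++-prefix []      r       _ _        = r , refl
        ++-prefix (b ∷ y) (a ∷ r) e (s≤s le) with List.∷-injective e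
        ... | refl , e′ with ++-prefix y r e′ le
        ...   | z , eq = z , cong (b ∷_) eq

        ∈-tabulated : ∀ A → x ∈ allWindows (rhs rules A) → x ∈ candidates
        ∈-tabulated A x∈ = ∈-concat⁺′ x∈ (∈-tabulate⁺ A)

        mutual
          infix∈candidates : ∀ {A u} → rules ⊢ inj₁ A ⇒ u → Infix u → x ∈ candidates
          infix∈candidates (rule {A} d) i with infix∈ d i
          ... | inj₁ x∈ = ∈-tabulated A x∈
          ... | inj₂ x∈ = x∈

          -- A subword that starts in the value of a symbol either reaches the last letter of that
          -- value, and is a window of this occurrence, or lies inside it, and the search descends.
          -- The result is a sum because `ss` may be a mere suffix of a right-hand side; its windows
          -- are assigned to a rule only in `infix∈candidates`.
          infix∈ : ∀ {ss u} → rules ⊢ ss ⇒* u → Infix u → x ∈ allWindows ss ⊎ x ∈ candidates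
          infix∈ [] (p , q , e) = contradiction x≢[]
              (λ le → 1+n≰n (≤-trans le (≤-reflexive
              (cong length (List.++-conicalˡ x q (List.++-conicalʳ p (x ++ q) e))))))
          infix∈ {s ∷ ss} (_∷_ {u = u₁} {u₂} d ds) (p , q , e) with ++-split p u₁ e
          ... | inj₁ (p′ , e′) with infix∈ ds (p′ , q , e′)
          ...   | inj₁ x∈ = inj₁ (∈-++⁺ʳ (windows s ss) x∈)
          ...   | inj₂ x∈ = inj₂ x∈
          infix∈ {s ∷ ss} (_∷_ {u = u₁} {u₂} d ds) (p , q , e) | inj₂ (r , r≢[] , e₁ , e₂) = cases d
              (≤-total (length r) (length x))
            where
            short : length r ≤ length x → x ∈ allWindows (s ∷ ss)
            short le = ∈-++⁺ˡ (crossing {p} {r} {q} s ss r≢[] le (trans e₁ (value-unique d))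
                          (trans e (cong₂ _++_ (value-unique d) (values-unique ds))))
            cases : rules ⊢ s ⇒ u₁ → length r ≤ length x ⊎ length x ≤ length r →
                    x ∈ allWindows (s ∷ ss) ⊎ x ∈ candidates
            cases _        (inj₁ le) = inj₁ (short le)
            -- The value of a terminal has one letter, so `r` is no longer than the nonempty `x`.
            cases term     (inj₂ le) = inj₁
                (short (≤-trans (≤-trans (m≤n+m (length r) (length p))
                (≤-reflexive (trans (sym (List.length-++ p)) (cong length e₁)))) x≢[]))
            cases (rule d₁) (inj₂ le) with ++-prefix x r e₂ le
            ... | z , eq = inj₂ (infix∈candidates d (p , z , trans (cong (p ++_) eq) e₁))

        infix-val∈candidates : Infix (val 𝔸) → x ∈ candidates
        infix-val∈candidates = infix∈candidates (v-derived start)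

  -- Counting in lists without repetitions.

  lookup-injective : ∀ {A : Set} {xs : List A} → Unique xs → ∀ i j →
                     List.lookup xs i ≡ List.lookup xs j → i ≡ j
  lookup-injective (_ ∷ _)  zero    zero    _ = refl
  lookup-injective (x∉ ∷ _) zero    (suc j) e = contradiction e (All.lookup x∉ (∈-lookup j))
  lookup-injective (x∉ ∷ _) (suc i) zero    e = contradiction (sym e) (All.lookup x∉ (∈-lookup i))
  lookup-injective (_ ∷ u)  (suc i) (suc j) e = cong suc (lookup-injective u i j e)

  pigeonhole : ∀ {A : Set} {xs ys : List A} → Unique xs → (∀ {x} → x ∈ xs → x ∈ ys) →
               length xs ≤ length ys
  pigeonhole {xs = xs} {ys} u sub = Fin.injective⇒≤ {f = λ i → index (sub (∈-lookup {xs = xs} i))}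
    λ {i} {j} e → lookup-injective u i j
      (trans (lookup-index (sub (∈-lookup i))) (trans (cong (List.lookup ys) e)
          (sym (lookup-index (sub (∈-lookup j))))))

  -- Splits the list into its short elements, counted by ys, and its long ones.
  count-short : ∀ {A : Set} κ {xs ys : List (List A)} → Unique xs →
                (∀ {x} → x ∈ xs → length x ≤ κ → x ∈ ys) →
                length xs * suc κ ≤ length (concat xs) + length ys * suc κ
  count-short {A} κ {xs} {ys} u sub = begin
    length xs * suc κ                                   ≤⟨ split xs ⟩
    length (concat xs) + length (shorts xs) * suc κ
      ≤⟨ +-monoʳ-≤ (length (concat xs)) (*-monoˡ-≤ (suc κ) (pigeonhole (filter⁺ short? u) λ x∈ → let x∈xs , le = ∈-filter⁻ short? {xs = xs} x∈ in sub x∈xs le)) ⟩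
    length (concat xs) + length ys * suc κ              ∎
    where
    open ≤-Reasoning
    short? : (x : List A) → Dec (length x ≤ κ)
    short? x = length x ≤? κ
    shorts : List (List A) → List (List A)
    shorts = List.filter short?
    split : ∀ zs → length zs * suc κ ≤ length (concat zs) + length (shorts zs) * suc κ
    split [] = z≤n
    split (z ∷ zs) = go (short? z)
      where
      go : Dec (length z ≤ κ) → suc (length zs) * suc κ ≤ length (z ++ concat zs) + length (shorts (z ∷ zs))
          * suc κ
      go (yes le) = begin
        suc κ + length zs * suc κ                                       ≤⟨ +-monoʳ-≤ (suc κ) (split zs) ⟩
        suc κ + (length (concat zs) + length (shorts zs) * suc κ)
          ≡⟨ +-assoc (suc κ) (length (concat zs)) _ ⟨
        suc κ + length (concat zs) + length (shorts zs) * suc κ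
          ≡⟨ cong (_+ length (shorts zs) * suc κ) (+-comm (suc κ) (length (concat zs))) ⟩
        length (concat zs) + suc κ + length (shorts zs) * suc κ
          ≡⟨ +-assoc (length (concat zs)) (suc κ) _ ⟩
        length (concat zs) + (suc κ + length (shorts zs) * suc κ)
          ≤⟨ +-monoˡ-≤ _ (≤-trans (m≤n+m _ (length z)) (≤-reflexive (sym (List.length-++ z)))) ⟩
        length (z ++ concat zs) + (suc κ + length (shorts zs) * suc κ)
          ≡⟨ cong (λ ys → length (z ++ concat zs) + length ys * suc κ) (List.filter-accept short? {x = z}
              {xs = zs} le) ⟨
        length (z ++ concat zs) + length (shorts (z ∷ zs)) * suc κ      ∎
      go (no long) = begin
        suc κ + length zs * suc κ                                       ≤⟨ +-mono-≤ (≰⇒> long) (split zs) ⟩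
        length z + (length (concat zs) + length (shorts zs) * suc κ)
          ≡⟨ +-assoc (length z) (length (concat zs)) _ ⟨
        length z + length (concat zs) + length (shorts zs) * suc κ
          ≡⟨ cong (_+ length (shorts zs) * suc κ) (List.length-++ z) ⟨
        length (z ++ concat zs) + length (shorts zs) * suc κ
          ≡⟨ cong (λ ys → length (z ++ concat zs) + length ys * suc κ) (List.filter-reject short? {x = z}
              {xs = zs} long) ⟨
        length (z ++ concat zs) + length (shorts (z ∷ zs)) * suc κ      ∎

  -- A discrete intermediate value argument, descending from `b`. It supplies κ, ⌊log₂ n⌋ and the
  -- side length `L`.
  crossover : (f : ℕ → ℕ) → ∀ {n} b → f 0 ≤ n → n < f b → ∃ λ i → f i ≤ n × n < f (suc i)
  crossover f zero    f0≤n n<fb = contradiction (≤-trans n<fb f0≤n) 1+n≰n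
  crossover f {n} (suc b) f0≤n n<fb with f b ≤? n
  ... | yes fb≤n = b , fb≤n , n<fb
  ... | no  fb≰n = crossover f b f0≤n (≰⇒> fb≰n)

  -- Upper bound on the size of the LZ78 grammar

  concat-infix : ∀ {A : Set} {n} (f : Fin n → List A) i → ∃₂ λ p q → p ++ f i ++ q ≡ concat (tabulate f)
  concat-infix f zero = [] , _ , refl
  concat-infix f (suc i) with concat-infix (f ∘ suc) i
  ... | p , q , e = f zero ++ p , q , trans (List.++-assoc (f zero) p _) (cong (f zero ++_) e)

  -- Multiplying the bound on `m` by m² produces the square of m (κ + 1), which is at most 2 n; this
  -- eliminates κ. The variable `c` stands for the number of candidates.
  cubic-arithmetic : ∀ {m g n κ c} → m * suc κ ≤ n + c * suc κ → 2 * c ≤ m → m ≤ 2 * g * (suc κ * suc κ) →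
                     m * m * m ≤ 8 * g * (n * n)
  cubic-arithmetic {m} {g} {n} {κ} {c} many few m≤ = begin
    m * m * m                                  ≤⟨ *-monoʳ-≤ (m * m) m≤ ⟩
    m * m * (2 * g * (suc κ * suc κ))          ≡⟨ lem₁ m g (suc κ) ⟩
    2 * g * (m * suc κ * (m * suc κ))          ≤⟨ *-monoʳ-≤ (2 * g) (*-mono-≤ half half) ⟩
    2 * g * (2 * n * (2 * n))                  ≡⟨ lem₂ g n ⟩
    8 * g * (n * n)                            ∎
    where
    open ≤-Reasoning
    lem₁ : ∀ m g t → m * m * (2 * g * (t * t)) ≡ 2 * g * (m * t * (m * t))
    lem₁ = solve-∀
    lem₂ : ∀ g n → 2 * g * (2 * n * (2 * n)) ≡ 8 * g * (n * n)
    lem₂ = solve-∀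
    lem₃ : ∀ m t → m * t + m * t ≡ 2 * (m * t)
    lem₃ = solve-∀
    lem₄ : ∀ n c t → 2 * (n + c * t) ≡ 2 * n + 2 * c * t
    lem₄ = solve-∀
    half : m * suc κ ≤ 2 * n
    half = +-cancelʳ-≤ (m * suc κ) _ _ (begin
      m * suc κ + m * suc κ    ≡⟨ lem₃ m (suc κ) ⟩
      2 * (m * suc κ)          ≤⟨ *-monoʳ-≤ 2 many ⟩
      2 * (n + c * suc κ)      ≡⟨ lem₄ n c (suc κ) ⟩
      2 * n + 2 * c * suc κ    ≤⟨ +-monoʳ-≤ (2 * n) (*-monoˡ-≤ (suc κ) few) ⟩
      2 * n + m * suc κ        ∎)

  module _ {w : List (Fin k)} (F : Factorization w) where
    open Factorization F

    factor-infix : ∀ i → ∃₂ λ p q → p ++ f (suc i) ++ q ≡ w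
    factor-infix i with concat-infix (f ∘ suc) i
    ... | p , q , e = p , q ++ f last , (begin
      p ++ f (suc i) ++ q ++ f last     ≡⟨ cong (p ++_) (List.++-assoc (f (suc i)) q _) ⟨
      p ++ (f (suc i) ++ q) ++ f last   ≡⟨ List.++-assoc p _ _ ⟨
      (p ++ f (suc i) ++ q) ++ f last   ≡⟨ cong (_++ f last) e ⟩
      concat (tabulate (f ∘ suc)) ++ f last ≡⟨ factors ⟩
      w                                 ∎)
      where open ≡-Reasoning

    factor-nonempty : ∀ i → 1 ≤ length (f (suc i))
    factor-nonempty i with f (suc i) in e
    ... | _ ∷ _ = s≤s z≤n
    ... | []    with () ← distinct {suc i} {zero} (trans e (sym f₀))

    factors-unique : Unique (tabulate (f ∘ suc))
    factors-unique = tabulate⁺ λ e → Fin.suc-injective (distinct e)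

    m³≤8gn² : (𝔸 : SLP k) → val 𝔸 ≡ w → m * m * m ≤ 8 * size 𝔸 * (length w * length w)
    m³≤8gn² 𝔸 val≡ with crossover (λ κ → 2 * size 𝔸 * (κ * κ)) {m} (suc m)
        (≤-trans (≤-reflexive (*-zeroʳ (2 * size 𝔸))) z≤n)
        -- At κ = m + 1 the function exceeds `m`, because a grammar has positive size.
        (≤-trans (m≤m*n (suc m) (suc m)) (m≤n*m (suc m * suc m) (2 * size 𝔸)
            {{m*n≢0 2 (size 𝔸) {{_}} {{size-nonZero 𝔸}}}}))
    ... | κ , few , many = cubic-arithmetic {m} {size 𝔸} {length w} {κ} {size 𝔸 * (κ * κ)} count
            (≤-trans (≤-reflexive (sym (*-assoc 2 (size 𝔸) (κ * κ)))) few) (<⇒≤ many)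
      where
      open ≤-Reasoning
      fs : List (List (Fin k))
      fs = tabulate (f ∘ suc)
      short∈ : ∀ {x} → x ∈ fs → length x ≤ κ → x ∈ candidates 𝔸 κ
      short∈ x∈ le with ∈-tabulate⁻ x∈
      ... | i , refl = infix-val∈candidates 𝔸 κ (factor-nonempty i) le
                         (let p , q , e = factor-infix i in p , q , trans e (sym val≡))
      count : m * suc κ ≤ length w + size 𝔸 * (κ * κ) * suc κ
      count = begin
        m * suc κ
          ≡⟨ cong (_* suc κ) (List.length-tabulate (f ∘ suc)) ⟨
        length fs * suc κ                                       ≤⟨ count-short κ factors-unique short∈ ⟩
        length (concat fs) + length (candidates 𝔸 κ) * suc κ
          ≤⟨ +-mono-≤ concat≤ (*-monoˡ-≤ (suc κ) (≤-reflexive (length-candidates 𝔸 κ))) ⟩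
        length w + size 𝔸 * (κ * κ) * suc κ                     ∎
        where
        concat≤ : length (concat fs) ≤ length w
        concat≤ = ≤-trans (m≤m+n _ (length (f last)))
                    (≤-reflexive (trans (sym (List.length-++ (concat fs))) (cong length factors)))

    module _ (w≢[] : w ≢ []) where

      m≤size-lz78 : suc m ≤ size (lz78SLP w≢[] F)
      m≤size-lz78 = N≤size (lz78Rules w≢[] F)

      m≢0 : 1 ≤ m
      m≢0 = go f f₀ last factors
        where
        go : ∀ {m} (f : Fin (suc m) → List (Fin k)) → f zero ≡ [] → ∀ last →
             concat (tabulate (f ∘ suc)) ++ f last ≡ w → 1 ≤ m
        go {zero}  f f₀ zero e = contradiction (trans (sym e) f₀) w≢[]
        go {suc m} f f₀ last e = s≤s z≤n

      size-lz78≤4m : size (lz78SLP w≢[] F) ≤ 4 * m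
      size-lz78≤4m = begin
        List⁺.length body₀ + Vec.sum (Vec.map List⁺.length (Vec.tabulate (factorBody w≢[] F)))
          ≤⟨ +-mono-≤ start≤ (rest≤ (factorBody w≢[] F) factorBody≤) ⟩
        -- The extra symbol for the last factor is absorbed by one of the `m ≥ 1` factors.
        (m + 1) + m * 2 ≤⟨ +-monoˡ-≤ (m * 2) (+-monoʳ-≤ m m≢0) ⟩
        m + m + m * 2   ≡⟨ lem m ⟩
        4 * m           ∎
        where
        open ≤-Reasoning
        lem : ∀ m → m + m + m * 2 ≡ 4 * m
        lem = solve-∀
        body₀ : List⁺ (Symbol k (suc m))
        body₀ = toList⁺ w≢[] F (startBody w≢[] F) (startBody≢[] w≢[] F)
        heads : List (Symbol k (suc m))
        heads = tabulate (inj₁ ∘ suc)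
        factor≤ : ∀ (j : Fin (suc m)) → length (factor {k} j) ≤ 1
        factor≤ zero    = z≤n
        factor≤ (suc j) = s≤s z≤n
        start≤ : List⁺.length body₀ ≤ m + 1
        start≤ = begin
          length (List⁺.toList body₀)
            ≡⟨ cong length (toList-toList⁺ w≢[] F (startBody w≢[] F) (startBody≢[] w≢[] F)) ⟩
          length (startBody w≢[] F)          ≡⟨ List.length-++ heads ⟩
          length heads + length (factor {k} last)
            ≤⟨ +-mono-≤ (≤-reflexive (List.length-tabulate {n = m} (inj₁ ∘ suc))) (factor≤ last) ⟩
          m + 1                              ∎
        rest≤ : ∀ {n} (h : Fin n → List⁺ (Symbol k (suc m))) → (∀ i → List⁺.length (h i) ≤ 2) →
                Vec.sum (Vec.map List⁺.length (Vec.tabulate h)) ≤ n * 2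
        rest≤ {zero}  h le = z≤n
        rest≤ {suc n} h le = +-mono-≤ (le zero) (rest≤ (h ∘ suc) (le ∘ suc))
        factorBody≤ : ∀ i → List⁺.length (factorBody w≢[] F i) ≤ 2
        factorBody≤ i with extends i
        ... | zero  , _ = s≤s z≤n
        ... | suc j , _ = s≤s (s≤s z≤n)

  -- Uniqueness of the LZ78 parse

  -- The dictionary `D` grows along the list, as in LZ78. The extension relation is a parameter so
  -- that chains can be built on numerical descriptions of words and then transported by
  -- `Chain-map`.
  data Chain {A : Set} (_⊰_ : A → A → Set) (D : List A) : List A → Set where
    []  : Chain _⊰_ D []
    add : ∀ {y x xs} → y ∈ D → y ⊰ x → Chain _⊰_ (x ∷ D) xs → Chain _⊰_ D (x ∷ xs)

  module _ {A : Set} {_⊰_ : A → A → Set} where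

    Chain-⊆ : ∀ {D E xs} → (∀ {x} → x ∈ D → x ∈ E) → Chain _⊰_ D xs → Chain _⊰_ E xs
    Chain-⊆ sub []           = []
    Chain-⊆ sub (add y∈ e c) =
      add (sub y∈) e (Chain-⊆ (λ { (here e) → here e ; (there p) → there (sub p) }) c)

    Chain-++ : ∀ {D} xs {ys} → Chain _⊰_ D xs → Chain _⊰_ (xs ++ D) ys → Chain _⊰_ D (xs ++ ys)
    Chain-++ []           []           d = d
    Chain-++ {D} (x ∷ xs) (add y∈ e c) d = add y∈ e (Chain-++ xs c (Chain-⊆ move d))
      where
      move : ∀ {z} → z ∈ x ∷ (xs ++ D) → z ∈ xs ++ x ∷ D
      move (here e) = ∈-++⁺ʳ xs (here e)
      move (there p) with ∈-++⁻ xs p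
      ... | inj₁ q = ∈-++⁺ˡ q
      ... | inj₂ q = ∈-++⁺ʳ xs (there q)

  Chain-map : ∀ {A B : Set} {_⊰_ : A → A → Set} {_⊰′_ : B → B → Set} (h : A → B) →
              (∀ {x y} → x ⊰ y → h x ⊰′ h y) →
              ∀ {D xs} → Chain _⊰_ D xs → Chain _⊰′_ (List.map h D) (List.map h xs)
  Chain-map h mono []           = []
  Chain-map h mono (add y∈ r c) = add (∈-map⁺ h y∈) (mono r) (Chain-map h mono c)

  module _ {A : Set} where

    _⊰_ : List A → List A → Set
    y ⊰ x = ∃ λ c → x ≡ y ++ List.[ c ]

    Chain-nonempty : ∀ {D xs} → Chain _⊰_ D xs → All (_∉ List.[ [] ]) xs
    Chain-nonempty []                           = []
    Chain-nonempty (add {y} _ (c , refl) chain) =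
      (λ { (here e) → contradiction (List.++-conicalʳ y _ e) λ () }) ∷ Chain-nonempty chain

    PrefixClosed : List (List A) → Set
    PrefixClosed D = ∀ p q → p ++ q ∈ D → p ∈ D

    snoc-prefix : ∀ (p : List A) {q y c} → p ++ q ≡ y ++ List.[ c ] → p ≡ y ++ List.[ c ] ⊎ ∃ λ q′ → p ++ q′ ≡ y
    snoc-prefix []      {y = y}     e = inj₂ (y , refl)
    snoc-prefix (a ∷ p) {y = []}    e with List.∷-injective e
    ... | refl , e′ = inj₁ (cong (a ∷_) (List.++-conicalˡ p _ e′))
    snoc-prefix (a ∷ p) {y = b ∷ y} e with List.∷-injective e
    ... | refl , e′ with snoc-prefix p e′
    ...   | inj₁ e₁       = inj₁ (cong (a ∷_) e₁)
    ...   | inj₂ (q′ , e₂) = inj₂ (q′ , cong (a ∷_) e₂)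

    snoc-closed : ∀ {D y c} → PrefixClosed D → y ∈ D → ∀ p q → p ++ q ≡ y ++ List.[ c ] →
                  p ≡ y ++ List.[ c ] ⊎ p ∈ D
    snoc-closed {D} closed y∈ p q e with snoc-prefix p e
    ... | inj₁ p≡       = inj₁ p≡
    ... | inj₂ (q′ , e′) = inj₂ (closed p q′ (subst (_∈ D) (sym e′) y∈))

    comparable : ∀ (x : List A) {z u v} → x ++ u ≡ z ++ v → (∃ λ t → x ++ t ≡ z) ⊎ (∃ λ t → z ++ t ≡ x)
    comparable []      {z}     e = inj₁ (z , refl)
    comparable (a ∷ x) {[]}    e = inj₂ (a ∷ x , refl)
    comparable (a ∷ x) {b ∷ z} e with List.∷-injective e
    ... | refl , e′ with comparable x e′
    ...   | inj₁ (t , eq) = inj₁ (t , cong (a ∷_) eq)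
    ...   | inj₂ (t , eq) = inj₂ (t , cong (a ∷_) eq)

    add-closed : ∀ {D y c} → PrefixClosed D → y ∈ D → PrefixClosed ((y ++ List.[ c ]) ∷ D)
    add-closed closed y∈ p q (here e) with snoc-closed closed y∈ p q e
    ... | inj₁ p≡ = here p≡
    ... | inj₂ p∈ = there p∈
    add-closed closed y∈ p q (there pq∈) = there (closed p q pq∈)

    tail-fresh : ∀ {D : List (List A)} {x xs} → All (_∉ D) xs → All (x ≢_) xs → All (_∉ x ∷ D) xs
    tail-fresh ns ds = All.zipWith (λ (n , d) → λ { (here e) → d (sym e) ; (there p) → n p }) (ns , ds)

    -- The next factor is the shortest prefix of the input outside the prefix-closed
    -- dictionary, so of two parses of the same text neither can deviate from the other.
    parse-unique : ∀ {D} xs ys {v l} → PrefixClosed D → Chain _⊰_ D xs → Unique xs → All (_∉ D) xs →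
                   Chain _⊰_ D ys → Unique ys → All (_∉ D) ys → l ∈ ys ++ D →
                   concat xs ++ v ≡ concat ys ++ l → length xs ≤ length ys
    parse-unique []       ys closed _ _ _ _ _ _ _ _ = z≤n
    -- Once `ys` is exhausted, the remaining text `l` is itself in the dictionary; its prefix `x`
    -- would be there too.
    parse-unique (x ∷ xs) [] {v} closed _ _ (x∉ ∷ _) _ _ _ l∈ e =
      contradiction (closed x (concat xs ++ v) (subst (_∈ _) (trans (sym e) (List.++-assoc x (concat xs) v))
          l∈)) x∉
    parse-unique {D} (x ∷ xs) (z ∷ zs) {v} {l} closed (add y∈ (_ , refl) c) (d ∷ ds) (x∉ ∷ ns)
                 (add y′∈ (_ , refl) c′) (d′ ∷ ds′) (z∉ ∷ ns′) l∈ e =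
      conclude x≡z
      where
      e′ : x ++ concat xs ++ v ≡ z ++ concat zs ++ l
      e′ = trans (sym (List.++-assoc x (concat xs) v)) (trans e (List.++-assoc z (concat zs) l))
      x≡z : x ≡ z
      x≡z with comparable x e′
      ... | inj₁ (t , eq) with snoc-closed closed y′∈ x t eq
      ...   | inj₁ x≡ = x≡
      ...   | inj₂ x∈ = contradiction x∈ x∉
      x≡z | inj₂ (t , eq) with snoc-closed closed y∈ z t eq
      ...   | inj₁ z≡ = sym z≡
      ...   | inj₂ z∈ = contradiction z∈ z∉
      conclude : x ≡ z → suc (length xs) ≤ suc (length zs)
      conclude eq = s≤s (parse-unique xs zs (add-closed closed y∈) c ds (tail-fresh ns d)
        (subst (λ u → Chain _⊰_ (u ∷ D) zs) (sym eq) c′) ds′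
        (subst (λ u → All (_∉ u ∷ D) zs) (sym eq) (tail-fresh ns′ d′))
        (move (l∈))
        (List.++-cancelˡ x _ _ (trans e′ (cong (_++ concat zs ++ l) (sym eq)))))
        where
        move : l ∈ z ∷ zs ++ D → l ∈ zs ++ x ∷ D
        move (here l≡) = ∈-++⁺ʳ zs (here (trans l≡ (sym eq)))
        move (there p) with ∈-++⁻ zs p
        ... | inj₁ q = ∈-++⁺ˡ q
        ... | inj₂ q = ∈-++⁺ʳ zs (there q)

  module _ {k : ℕ} {w : List (Fin k)} (F : Factorization w) where
    open Factorization F

    -- `tabulate` recurses on tails while `extends` refers to indices of the whole factorization;
    -- `e` and the offset `o` translate between the two.
    chain-from : ∀ {n o} (e : Fin n → Fin m) → (∀ i → toℕ (e i) ≡ o + toℕ i) → ∀ D →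
                 (∀ j → toℕ j ≤ o → f j ∈ D) → Chain _⊰_ D (tabulate (f ∘ suc ∘ e))
    chain-from {zero}  e _ D known = []
    chain-from {suc n} {o} e e≡ D known with extends (e zero)
    ... | j , a , j< , eq = add (known j j≤) (a , eq)
          (chain-from {n} {suc o} (e ∘ suc) (λ i → trans (e≡ (suc i)) (+-suc o (toℕ i))) _ known′)
      where
      e₀ : toℕ (e zero) ≡ o
      e₀ = trans (e≡ zero) (+-identityʳ o)
      j≤ : toℕ j ≤ o
      j≤ = ≤-pred (subst (λ n → toℕ j < suc n) e₀ j<)
      known′ : ∀ i → toℕ i ≤ suc o → f i ∈ f (suc (e zero)) ∷ D
      known′ i i≤ with m≤n⇒m<n∨m≡n i≤
      ... | inj₁ (s≤s i≤o) = there (known i i≤o)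
      ... | inj₂ i≡        = here (cong f (Fin.toℕ-injective (trans i≡ (cong suc (sym e₀)))))

    -- Bounds the number of factors from below without running `factorize`: exhibiting distinct
    -- words that form a chain and spell a prefix of `w` is enough. The remainder `v` is arbitrary,
    -- which later admits padding.
    parsed-length≤m : ∀ xs {v} → Chain _⊰_ List.[ [] ] xs → Unique xs →
                      concat xs ++ v ≡ w → length xs ≤ m
    parsed-length≤m xs c u e = subst (length xs ≤_) (List.length-tabulate (f ∘ suc))
      (parse-unique xs (tabulate (f ∘ suc)) closed c u (Chain-nonempty c)
        chain (tabulate⁺ (λ e → Fin.suc-injective (distinct e))) (Chain-nonempty chain)
        last∈ (trans e (sym factors)))
      where
      chain : Chain _⊰_ List.[ [] ] (tabulate (f ∘ suc))
      chain = chain-from (λ i → i) (λ _ → refl) _ (λ { zero _ → here f₀ })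
      closed : PrefixClosed List.[ [] ]
      closed []      q p∈ = here refl
      closed (_ ∷ _) q (here ())
      last∈ : f last ∈ tabulate (f ∘ suc) ++ List.[ [] ]
      last∈ with last
      ... | zero  = ∈-++⁺ʳ (tabulate (f ∘ suc)) (here f₀)
      ... | suc i = ∈-++⁺ˡ (∈-tabulate⁺ i)

  -- Iterated concatenation and powers of words.

  module _ {A : Set} where

    loop : (ℕ → List A) → ℕ → List A
    loop F zero    = []
    loop F (suc n) = loop F n ++ F n

    ∈-loop⁺ : ∀ (F : ℕ → List A) {n x} i → i < n → x ∈ F i → x ∈ loop F n
    ∈-loop⁺ F {suc n} i i<n x∈ with m≤n⇒m<n∨m≡n i<n
    ... | inj₁ (s≤s i<n′) = ∈-++⁺ˡ (∈-loop⁺ F i i<n′ x∈)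
    ... | inj₂ refl       = ∈-++⁺ʳ (loop F n) x∈

    ∈-loop⁻ : ∀ (F : ℕ → List A) n {x} → x ∈ loop F n → ∃ λ i → i < n × x ∈ F i
    ∈-loop⁻ F (suc n) x∈ with ∈-++⁻ (loop F n) x∈
    ... | inj₁ x∈ˡ = let i , i<n , x∈F = ∈-loop⁻ F n x∈ˡ in i , m<n⇒m<1+n i<n , x∈F
    ... | inj₂ x∈ʳ = n , ≤-refl , x∈ʳ

    length-loop : ∀ (F : ℕ → List A) n c → (∀ i → i < n → length (F i) ≤ c) → length (loop F n) ≤ n * c
    length-loop F zero    c le = z≤n
    length-loop F (suc n) c le = begin
      length (loop F n ++ F n)       ≡⟨ List.length-++ (loop F n) ⟩
      length (loop F n) + length (F n)
        ≤⟨ +-mono-≤ (length-loop F n c (λ i i<n → le i (m<n⇒m<1+n i<n))) (le n ≤-refl) ⟩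
      n * c + c                      ≡⟨ +-comm (n * c) c ⟩
      c + n * c                      ∎
      where open ≤-Reasoning

    length-loop≥ : ∀ (F : ℕ → List A) n c → (∀ i → c ≤ length (F i)) → n * c ≤ length (loop F n)
    length-loop≥ F zero    c le = z≤n
    length-loop≥ F (suc n) c le = begin
      c + n * c                      ≡⟨ +-comm c (n * c) ⟩
      n * c + c                      ≤⟨ +-mono-≤ (length-loop≥ F n c le) (le n) ⟩
      length (loop F n) + length (F n) ≡⟨ List.length-++ (loop F n) ⟨
      length (loop F n ++ F n)       ∎
      where open ≤-Reasoning

    Chain-loop : ∀ {_⊰_ : A → A → Set} {D} (F : ℕ → List A) n →
                 (∀ i → i < n → Chain _⊰_ (loop F i ++ D) (F i)) → Chain _⊰_ D (loop F n)
    Chain-loop F zero    c = []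
    Chain-loop F (suc n) c = Chain-++ (loop F n) (Chain-loop F n (λ i i<n → c i (m<n⇒m<1+n i<n))) (c n ≤-refl)

    -- If the iteration number can be read off an element, different iterations are disjoint; no
    -- pairwise comparison of elements is required.
    Unique-loop : ∀ (F : ℕ → List A) (stage : A → ℕ) n →
                  (∀ i → i < n → ∀ {x} → x ∈ F i → stage x ≡ i) →
                  (∀ i → i < n → Unique (F i)) → Unique (loop F n)
    Unique-loop F stage zero    _  _ = []
    Unique-loop F stage (suc n) st u = ++⁺ (Unique-loop F stage n (λ i i<n → st i (m<n⇒m<1+n i<n))
        (λ i i<n → u i (m<n⇒m<1+n i<n))) (u n ≤-refl)
      λ (x∈ˡ , x∈ʳ) → let i , i<n , x∈F = ∈-loop⁻ F n x∈ˡ in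
        <⇒≢ i<n (trans (sym (st i (m<n⇒m<1+n i<n) x∈F)) (st n ≤-refl x∈ʳ))

    infix 8 _^^_
    _^^_ : List A → ℕ → List A
    u ^^ n = concat (replicate n u)

    ^^-snoc : ∀ u n → u ^^ suc n ≡ u ^^ n ++ u
    ^^-snoc u zero    = List.++-identityʳ u
    ^^-snoc u (suc n) = trans (cong (u ++_) (^^-snoc u n)) (sym (List.++-assoc u (u ^^ n) u))

    ^^-+ : ∀ u m n → u ^^ (m + n) ≡ u ^^ m ++ u ^^ n
    ^^-+ u zero    n = refl
    ^^-+ u (suc m) n = trans (cong (u ++_) (^^-+ u m n)) (sym (List.++-assoc u (u ^^ m) _))

    length-^^ : ∀ u n → length (u ^^ n) ≡ n * length u
    length-^^ u zero    = refl
    length-^^ u (suc n) = trans (List.length-++ u) (cong (length u +_) (length-^^ u n))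

    loop-const : ∀ u n → loop (λ _ → u) n ≡ u ^^ n
    loop-const u zero    = refl
    loop-const u (suc n) = trans (cong (_++ u) (loop-const u n)) (sym (^^-snoc u n))

  -- Factor boundaries and period boundaries do not coincide. The word `s i` is the overhang: after
  -- `i` iterations the factors have spelled the first `i` pieces of text and `s i` beyond them.
  concat-loop : ∀ {A : Set} (s : ℕ → List A) (X : ℕ → List (List A)) (Y : ℕ → List A) n →
                (∀ i → i < n → s i ++ concat (X i) ≡ Y i ++ s (suc i)) →
                s 0 ++ concat (loop X n) ≡ loop Y n ++ s n
  concat-loop s X Y zero    e = List.++-identityʳ (s 0)
  concat-loop s X Y (suc n) e = begin
    s 0 ++ concat (loop X n ++ X n)          ≡⟨ cong (s 0 ++_) (List.concat-++ (loop X n) (X n)) ⟨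
    s 0 ++ concat (loop X n) ++ concat (X n) ≡⟨ List.++-assoc (s 0) _ _ ⟨
    (s 0 ++ concat (loop X n)) ++ concat (X n)
      ≡⟨ cong (_++ concat (X n)) (concat-loop s X Y n (λ i i<n → e i (m<n⇒m<1+n i<n))) ⟩
    (loop Y n ++ s n) ++ concat (X n)        ≡⟨ List.++-assoc (loop Y n) _ _ ⟩
    loop Y n ++ s n ++ concat (X n)          ≡⟨ cong (loop Y n ++_) (e n ≤-refl) ⟩
    loop Y n ++ Y n ++ s (suc n)             ≡⟨ List.++-assoc (loop Y n) _ _ ⟨
    (loop Y n ++ Y n) ++ s (suc n)           ∎
    where open ≡-Reasoning

  map-loop : ∀ {A B : Set} (h : A → B) F n → List.map h (loop F n) ≡ loop (List.map h ∘ F) n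
  map-loop h F zero    = refl
  map-loop h F (suc n) = trans (List.map-++ h (loop F n) (F n)) (cong (_++ List.map h (F n)) (map-loop h F n))

  -- run i stands for aⁱ and block i t j for aⁱ bᵗ⁺¹ aʲ.
  data Shape : Set where
    run   : ℕ → Shape
    block : ℕ → ℕ → ℕ → Shape

  infix 4 _⋖_
  data _⋖_ : Shape → Shape → Set where
    run-run     : ∀ {i} → run i ⋖ run (suc i)
    run-block   : ∀ {i} → run i ⋖ block i 0 0
    block-b     : ∀ {i t} → block i t 0 ⋖ block i (suc t) 0
    block-a     : ∀ {i t j} → block i t j ⋖ block i t (suc j)

  replicate-snoc : ∀ {A : Set} (c : A) n → replicate (suc n) c ≡ replicate n c ++ List.[ c ]
  replicate-snoc c zero    = refl
  replicate-snoc c (suc n) = cong (c ∷_) (replicate-snoc c n)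

  replicate-+ : ∀ {A : Set} (c : A) m n → replicate (m + n) c ≡ replicate m c ++ replicate n c
  replicate-+ c zero    n = refl
  replicate-+ c (suc m) n = cong (c ∷_) (replicate-+ c m n)

  module Words {A : Set} (a b : A) (a≢b : a ≢ b) where

    word : Shape → List A
    word (run i)       = replicate i a
    word (block i t j) = replicate i a ++ replicate (suc t) b ++ replicate j a

    word-mono : ∀ {x y} → x ⋖ y → word x ⊰ word y
    word-mono (run-run {i})   = a , replicate-snoc a i
    word-mono (run-block {i}) = b , refl
    word-mono (block-b {i} {t}) = b , (begin
      replicate i a ++ replicate (suc (suc t)) b ++ []
        ≡⟨ cong (λ z → replicate i a ++ z ++ []) (replicate-snoc b (suc t)) ⟩
      replicate i a ++ (replicate (suc t) b ++ List.[ b ]) ++ []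
        ≡⟨ cong (replicate i a ++_) (List.++-assoc (replicate (suc t) b) _ []) ⟩
      replicate i a ++ replicate (suc t) b ++ List.[ b ]           ≡⟨ List.++-assoc (replicate i a) _ _ ⟨
      (replicate i a ++ replicate (suc t) b) ++ List.[ b ]
        ≡⟨ cong (λ z → (replicate i a ++ z) ++ List.[ b ]) (List.++-identityʳ _) ⟨
      (replicate i a ++ replicate (suc t) b ++ []) ++ List.[ b ]   ∎)
      where open ≡-Reasoning
    word-mono (block-a {i} {t} {j}) = a , (begin
      replicate i a ++ replicate (suc t) b ++ replicate (suc j) a
        ≡⟨ cong (λ z → replicate i a ++ replicate (suc t) b ++ z) (replicate-snoc a j) ⟩
      replicate i a ++ replicate (suc t) b ++ replicate j a ++ List.[ a ]
        ≡⟨ cong (replicate i a ++_) (List.++-assoc (replicate (suc t) b) _ _) ⟨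
      replicate i a ++ (replicate (suc t) b ++ replicate j a) ++ List.[ a ]
        ≡⟨ List.++-assoc (replicate i a) _ _ ⟨
      (replicate i a ++ replicate (suc t) b ++ replicate j a) ++ List.[ a ] ∎)
      where open ≡-Reasoning

    replicate-injective : ∀ {c : A} m n → replicate m c ≡ replicate n c → m ≡ n
    replicate-injective {c} m n e =
      trans (sym (List.length-replicate m {c})) (trans (cong length e) (List.length-replicate n {c}))

    tail-injective : ∀ t t′ {j j′} → replicate t b ++ replicate j a ≡ replicate t′ b ++ replicate j′ a →
                     t ≡ t′ × j ≡ j′
    tail-injective zero    zero     {j}     {j′}    e = refl , replicate-injective j j′ e
    tail-injective zero    (suc t′) {suc j}         e = contradiction (List.∷-injectiveˡ e) a≢b
    tail-injective (suc t) zero     {j}     {suc j′} e = contradiction (sym (List.∷-injectiveˡ e)) a≢b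
    tail-injective (suc t) (suc t′)                 e with tail-injective t t′ (List.∷-injectiveʳ e)
    ... | refl , refl = refl , refl

    run≢block : ∀ i i′ {t j} → word (run i) ≢ word (block i′ t j)
    run≢block (suc i) zero     e = a≢b (List.∷-injectiveˡ e)
    run≢block (suc i) (suc i′) {t} {j} e = run≢block i i′ {t} {j} (List.∷-injectiveʳ e)

    -- The run of b in a block is nonempty, so the exponents are determined by the positions where
    -- the letter changes. Distinctness of factors thereby becomes distinctness of tuples of
    -- numbers.
    word-injective : ∀ {x y} → word x ≡ word y → x ≡ y
    word-injective {run i}       {run i′}         e = cong run (replicate-injective i i′ e)
    word-injective {run i}       {block i′ t j}   e = contradiction e (run≢block i i′ {t} {j})
    word-injective {block i t j} {run i′}         e = contradiction (sym e) (run≢block i′ i {t} {j})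
    word-injective {block i t j} {block i′ t′ j′} e = go i i′ e
      where
      go : ∀ i i′ → word (block i t j) ≡ word (block i′ t′ j′) → block i t j ≡ block i′ t′ j′
      go zero    zero     e with tail-injective (suc t) (suc t′) e
      ... | refl , refl = refl
      go zero    (suc i′) e = contradiction (sym (List.∷-injectiveˡ e)) a≢b
      go (suc i) zero     e = contradiction (List.∷-injectiveˡ e) a≢b
      go (suc i) (suc i′) e with go i i′ (List.∷-injectiveʳ e)
      ... | refl = refl

  -- A text with many LZ78 factors

  module Parse (L′ q′ : ℕ) where

    L q : ℕ
    L = suc L′
    q = suc q′

    -- The wide factor ends with aʲ and the narrow one starts with a^(L - j), together a run of
    -- length L; likewise the trailing a^ρ of the narrow factor and the leading a^(2L - ρ) of the
    -- next wide one form a run of length 2L.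
    steps : ℕ → ℕ → ℕ → List Shape
    steps ρ j t = block (2 * L ∸ ρ) t j ∷ block (L ∸ j) t ρ ∷ []

    pass : ℕ → ℕ → List Shape
    pass ρ j = loop (steps ρ j) q

    -- Its run of b has length q + 1, longer than any in a pass, so the block cannot have occurred
    -- there. Since `y` ends with 2L letters a, the run takes ρ + 1 letters from what follows.
    separator : ℕ → List Shape
    separator ρ = block (2 * L ∸ ρ) q 0 ∷ run (suc (2 * L + ρ)) ∷ []

    round : ℕ → List Shape
    round ρ = loop (pass ρ) L ++ separator ρ

    -- Supplies the runs of a from which the first block of each row or column is extended.
    prelude : List Shape
    prelude = loop (λ r → List.[ run (suc r) ]) (2 * L)

    shapes : List Shape
    shapes = prelude ++ loop round L

    dictionary : List Shape
    dictionary = prelude ++ List.[ run 0 ]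

    run∈ : ∀ i → i ≤ 2 * L → run i ∈ dictionary
    run∈ zero    _  = ∈-++⁺ʳ prelude (here refl)
    run∈ (suc i) le = ∈-++⁺ˡ (∈-loop⁺ _ i le (here refl))

    shapes-chain : Chain _⋖_ List.[ run 0 ] shapes
    shapes-chain = Chain-++ prelude (Chain-loop _ (2 * L) prelude-chain) (Chain-loop round L round-chain)
      where
      prelude-chain : ∀ i → i < 2 * L → Chain _⋖_ (loop (λ r → List.[ run (suc r) ]) i ++ List.[ run 0 ])
          List.[ run (suc i) ]
      prelude-chain zero    _ = add (here refl) run-run []
      prelude-chain (suc i) _ = add (∈-++⁺ˡ (∈-loop⁺ _ i ≤-refl (here refl))) run-run []

      L≤2L : L ≤ 2 * L
      L≤2L = m≤m+n L _

      module _ (ρ : ℕ) (ρ<L : ρ < L) where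
        D : List Shape
        D = loop round ρ ++ dictionary

        in-D : ∀ {i} → i ≤ 2 * L → run i ∈ D
        in-D le = ∈-++⁺ʳ (loop round ρ) (run∈ _ le)

        -- For j > 0 the predecessor comes from the previous pass of the same round; for j = 0 it is
        -- the preceding b-exponent or a run of the prelude.
        wide : ∀ j t → j < L → t < q → ∃ λ y → y ∈ loop (steps ρ j) t ++ loop (pass ρ) j ++ D × y ⋖ block
            (2 * L ∸ ρ) t j
        wide zero    zero    j<L t<q = _ , in-D (m∸n≤m _ ρ) , run-block
        wide zero    (suc t) j<L t<q = _ , ∈-++⁺ˡ (∈-loop⁺ _ t ≤-refl (here refl)) , block-b
        wide (suc j) t       j<L t<q = _ , ∈-++⁺ʳ (loop (steps ρ (suc j)) t)
            (∈-++⁺ˡ (∈-loop⁺ (pass ρ) j ≤-refl (∈-loop⁺ (steps ρ j) t t<q (here refl)))) , block-a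

      -- Here the trailing exponent is ρ, so for ρ > 0 the predecessor was created one whole round
      -- earlier, in the pass with the same `j`.
      narrow : ∀ ρ j t → ρ < L → j < L → t < q →
               ∃ λ y → y ∈ loop (steps ρ j) t ++ loop (pass ρ) j ++ loop round ρ ++ dictionary × y ⋖ block
                   (L ∸ j) t ρ
      narrow zero    j zero    ρ<L j<L t<q = _ , ∈-++⁺ʳ (loop (pass zero) j)
          (run∈ _ (≤-trans (m∸n≤m L j) L≤2L)) , run-block
      narrow zero    j (suc t) ρ<L j<L t<q = _ , ∈-++⁺ˡ (∈-loop⁺ (steps zero j) t ≤-refl
          (there (here refl))) , block-b
      narrow (suc ρ) j t       ρ<L j<L t<q = _ , ∈-++⁺ʳ (loop (steps (suc ρ) j) t)
          (∈-++⁺ʳ (loop (pass (suc ρ)) j)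
        (∈-++⁺ˡ (∈-loop⁺ round ρ ≤-refl
            (∈-++⁺ˡ (∈-loop⁺ (pass ρ) j j<L (∈-loop⁺ (steps ρ j) t t<q (there (here refl)))))))) , block-a

      round-chain : ∀ ρ → ρ < L → Chain _⋖_ (loop round ρ ++ dictionary) (round ρ)
      round-chain ρ ρ<L = Chain-++ (loop (pass ρ) L)
        (Chain-loop (pass ρ) L λ j j<L → Chain-loop (steps ρ j) q λ t t<q →
          let _ , y∈ , y⋖ = wide ρ ρ<L j t j<L t<q ; _ , z∈ , z⋖ = narrow ρ j t ρ<L j<L t<q in
          add y∈ y⋖ (add (there z∈) z⋖ []))
        -- The predecessor of the separator's block must end in b, so it is the wide factor of the
        -- last step of pass 0. The run extends the run of the previous separator, or the longest
        -- run of the prelude when ρ = 0.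
        (add (∈-++⁺ˡ (∈-loop⁺ (pass ρ) {L} 0 (s≤s z≤n) (∈-loop⁺ (steps ρ 0) q′ ≤-refl (here refl)))) block-b
          (add (there (∈-++⁺ʳ (loop (pass ρ) L) (longest ρ))) run-run []))
        where
        longest : ∀ ρ → run (2 * L + ρ) ∈ loop round ρ ++ dictionary
        longest zero    = run∈ _ (≤-reflexive (+-identityʳ (2 * L)))
        longest (suc ρ) = ∈-++⁺ˡ (∈-loop⁺ round ρ ≤-refl (∈-++⁺ʳ (loop (pass ρ) L)
          (there (here (cong run (+-suc (2 * L) ρ))))))

    -- stage, passStage and stepStage recover the values of ρ, j and t from a shape of the
    -- list; so different iterations of each loop yield different shapes.
    stage : Shape → ℕ
    stage (run i)       = i ∸ suc (2 * L)
    stage (block i t j) with L <? i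
    ... | yes _ = 2 * L ∸ i
    ... | no  _ = j

    passStage : Shape → ℕ
    passStage (run i)       = 0
    passStage (block i t j) with L <? i
    ... | yes _ = j
    ... | no  _ = L ∸ i

    stepStage : Shape → ℕ
    stepStage (run i)       = q
    stepStage (block i t j) = t

    -- This is why the long runs have length 2L: leading exponents of wide factors exceed L while
    -- those of narrow factors do not, so the two tables never meet.
    wide>L : ∀ {ρ} → ρ < L → L < 2 * L ∸ ρ
    wide>L {ρ} ρ<L = m+n≤o⇒m≤o∸n (suc L) (begin
      suc L + ρ     ≡⟨ +-suc L ρ ⟨
      L + suc ρ     ≤⟨ +-monoʳ-≤ L ρ<L ⟩
      L + L         ≡⟨ cong (L +_) (+-identityʳ L) ⟨
      2 * L         ∎)
      where open ≤-Reasoning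

    ρ≤2L : ∀ {ρ} → ρ < L → ρ ≤ 2 * L
    ρ≤2L ρ<L = ≤-trans (<⇒≤ ρ<L) (m≤m+n L _)

    stage-wide : ∀ {ρ} t j → ρ < L → stage (block (2 * L ∸ ρ) t j) ≡ ρ
    stage-wide {ρ} t j ρ<L with L <? 2 * L ∸ ρ
    ... | yes _ = m∸[m∸n]≡n (ρ≤2L ρ<L)
    ... | no ¬p = contradiction (wide>L ρ<L) ¬p

    stage-narrow : ∀ ρ t j → stage (block (L ∸ j) t ρ) ≡ ρ
    stage-narrow ρ t j with L <? L ∸ j
    ... | yes p = contradiction (≤-trans p (m∸n≤m L j)) 1+n≰n
    ... | no _  = refl

    passStage-wide : ∀ {ρ} t j → ρ < L → passStage (block (2 * L ∸ ρ) t j) ≡ j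
    passStage-wide {ρ} t j ρ<L with L <? 2 * L ∸ ρ
    ... | yes _ = refl
    ... | no ¬p = contradiction (wide>L ρ<L) ¬p

    passStage-narrow : ∀ ρ t {j} → j < L → passStage (block (L ∸ j) t ρ) ≡ j
    passStage-narrow ρ t {j} j<L with L <? L ∸ j
    ... | yes p = contradiction (≤-trans p (m∸n≤m L j)) 1+n≰n
    ... | no _  = m∸[m∸n]≡n (<⇒≤ j<L)

    block-injective : ∀ {i t j i′ t′ j′} → block i t j ≡ block i′ t′ j′ → i ≡ i′
    block-injective refl = refl

    pass-unique : ∀ ρ j → ρ < L → Unique (pass ρ j)
    pass-unique ρ j ρ<L = Unique-loop (steps ρ j) stepStage q
      (λ { t _ (here refl) → refl ; t _ (there (here refl)) → refl })
      (λ t _ → ((λ e → <⇒≢ (≤-trans (s≤s (m∸n≤m L j)) (wide>L ρ<L)) (sym (block-injective e))) ∷ []) ∷ [] ∷ [])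

    ∈-pass⁻ : ∀ {ρ j x} → x ∈ pass ρ j → ∃ λ t → t < q × (x ≡ block (2 * L ∸ ρ) t j ⊎ x ≡ block (L ∸ j) t ρ)
    ∈-pass⁻ {ρ} {j} x∈ with ∈-loop⁻ (steps ρ j) q x∈
    ... | t , t<q , here e         = t , t<q , inj₁ e
    ... | t , t<q , there (here e) = t , t<q , inj₂ e

    round-unique : ∀ ρ → ρ < L → Unique (round ρ)
    round-unique ρ ρ<L = ++⁺
      (Unique-loop (pass ρ) passStage L passStage≡ (λ j _ → pass-unique ρ j ρ<L))
      (((λ ()) ∷ []) ∷ [] ∷ [])
      -- Both separator factors have `stepStage` equal to `q`, the run by the default value chosen
      -- there, and factors of passes have less.
      λ { (x∈ , here refl) → <⇒≢ (stepStage<q x∈) refl ; (x∈ , there (here refl)) → <⇒≢ (stepStage<q x∈) refl }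
      where
      passStage≡ : ∀ j → j < L → ∀ {x} → x ∈ pass ρ j → passStage x ≡ j
      passStage≡ j j<L x∈ with ∈-pass⁻ x∈
      ... | t , _ , inj₁ refl = passStage-wide t j ρ<L
      ... | t , _ , inj₂ refl = passStage-narrow ρ t j<L
      stepStage<q : ∀ {x} → x ∈ loop (pass ρ) L → stepStage x < q
      stepStage<q x∈ with ∈-loop⁻ (pass ρ) L x∈
      ... | j , _ , x∈ʲ with ∈-pass⁻ {ρ} {j} x∈ʲ
      ...   | t , t<q , inj₁ refl = t<q
      ...   | t , t<q , inj₂ refl = t<q

    shapes-unique : Unique shapes
    shapes-unique = ++⁺
      (Unique-loop _ (λ { (run i) → pred i ; (block _ _ _) → 0 }) (2 * L) (λ { i _ (here refl) → refl })
          (λ _ _ → [] ∷ []))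
      (Unique-loop round stage L (λ ρ ρ<L → stage≡ ρ ρ<L) round-unique)
      disjoint
      where
      stage≡ : ∀ ρ → ρ < L → ∀ {x} → x ∈ round ρ → stage x ≡ ρ
      stage≡ ρ ρ<L x∈ with ∈-++⁻ (loop (pass ρ) L) x∈
      ... | inj₂ (here refl)         = stage-wide q 0 ρ<L
      ... | inj₂ (there (here refl)) = m+n∸m≡n (suc (2 * L)) ρ
      ... | inj₁ x∈ᵖ with ∈-loop⁻ (pass ρ) L x∈ᵖ
      ...   | j , j<L , x∈ʲ with ∈-pass⁻ {ρ} {j} x∈ʲ
      ...     | t , _ , inj₁ refl = stage-wide t j ρ<L
      ...     | t , _ , inj₂ refl = stage-narrow ρ t j
      disjoint : ∀ {x} → ¬ (x ∈ prelude × x ∈ loop round L)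
      disjoint (x∈ , x∈′) with ∈-loop⁻ _ (2 * L) x∈ | ∈-loop⁻ round L x∈′
      ... | i , i<2L , here refl | ρ , _ , x∈ʳ with ∈-++⁻ (loop (pass ρ) L) x∈ʳ
      -- The only runs in a round come from separators and are longer than 2L, the maximum in the
      -- prelude.
      ...   | inj₂ (there (here e)) = <⇒≱ i<2L (≤-trans (m≤m+n (2 * L) ρ)
          (≤-reflexive (sym (suc-injective (run-injective e)))))
        where
        run-injective : ∀ {m n} → run m ≡ run n → m ≡ n
        run-injective refl = refl
      ...   | inj₁ x∈ᵖ with ∈-loop⁻ (pass ρ) L x∈ᵖ
      ...     | j , _ , x∈ʲ with ∈-pass⁻ {ρ} {j} x∈ʲ
      ...       | _ , _ , inj₁ ()
      ...       | _ , _ , inj₂ ()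

    2qL²≤length-shapes : L * (L * (q * 2)) ≤ length shapes
    2qL²≤length-shapes = begin
      L * (L * (q * 2))
        ≤⟨ length-loop≥ round L _ (λ ρ → ≤-trans (length-loop≥ (pass ρ) L _ (λ j → length-loop≥ (steps ρ j)
            q 2 (λ _ → ≤-refl))) (≤-trans (m≤m+n _ 2) (≤-reflexive (sym (List.length-++ (loop (pass ρ) L)))))) ⟩
      length (loop round L)          ≤⟨ m≤n+m _ (length prelude) ⟩
      length prelude + length (loop round L) ≡⟨ List.length-++ prelude ⟨
      length shapes                  ∎
      where open ≤-Reasoning

    -- The text spelled by the factors.

    module Text {A : Set} (a b : A) (a≢b : a ≢ b) where
      open Words a b a≢b

      infix 9 a^_ b^_
      a^_ b^_ : ℕ → List A
      a^ n = replicate n a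
      b^ n = replicate n b

      block² : ℕ → List A
      block² t = a^ (2 * L) ++ b^ (suc t) ++ a^ L ++ b^ (suc t)

      u y : List A
      u = loop block² q
      y = a^ (2 * L) ++ b^ (suc q) ++ a^ (2 * L)

      triangle : ℕ → ℕ
      triangle zero    = 0
      triangle (suc n) = triangle n + suc n

      prelude-text : ∀ n → concat (List.map word (loop (λ r → List.[ run (suc r) ]) n)) ≡ a^ (triangle n)
      prelude-text zero    = refl
      prelude-text (suc n) = begin
        concat (List.map word (loop _ n ++ List.[ run (suc n) ]))
          ≡⟨ cong concat (List.map-++ word (loop _ n) _) ⟩
        concat (List.map word (loop _ n) ++ List.[ a^ (suc n) ])
          ≡⟨ List.concat-++ (List.map word (loop _ n)) _ ⟨
        concat (List.map word (loop _ n)) ++ a^ (suc n) ++ []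
          ≡⟨ cong₂ _++_ (prelude-text n) (List.++-identityʳ (a^ (suc n))) ⟩
        a^ (triangle n) ++ a^ (suc n)
          ≡⟨ replicate-+ a (triangle n) (suc n) ⟨
        a^ (triangle (suc n))                                               ∎
        where open ≡-Reasoning

      fuse : ∀ {c : A} m n {l xs} → m + n ≡ l → replicate m c ++ replicate n c ++ xs ≡ replicate l c ++ xs
      fuse {c} m n {xs = xs} refl = trans (sym (List.++-assoc (replicate m c) _ xs))
          (cong (_++ xs) (sym (replicate-+ c m n)))

      -- The counters disappear from `block² t`; hence all L² passes read the same word `u` and the
      -- text is compressible.
      steps-text : ∀ ρ j → ρ < L → j < L → ∀ t →
                   a^ ρ ++ concat (List.map word (steps ρ j t)) ≡ block² t ++ a^ ρ
      steps-text ρ j ρ<L j<L t = begin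
        a^ ρ ++ (a^ (2 * L ∸ ρ) ++ β ++ a^ j) ++ (a^ (L ∸ j) ++ β ++ a^ ρ) ++ []
          ≡⟨ cong (λ z → a^ ρ ++ (a^ (2 * L ∸ ρ) ++ β ++ a^ j) ++ z) (List.++-identityʳ _) ⟩
        a^ ρ ++ (a^ (2 * L ∸ ρ) ++ β ++ a^ j) ++ a^ (L ∸ j) ++ β ++ a^ ρ
          ≡⟨ cong (a^ ρ ++_) (trans (List.++-assoc (a^ (2 * L ∸ ρ)) _ _) (cong (a^ (2 * L ∸ ρ) ++_)
              (List.++-assoc β _ _))) ⟩
        a^ ρ ++ a^ (2 * L ∸ ρ) ++ β ++ a^ j ++ a^ (L ∸ j) ++ β ++ a^ ρ
          ≡⟨ fuse ρ (2 * L ∸ ρ) (m+[n∸m]≡n (ρ≤2L ρ<L)) ⟩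
        a^ (2 * L) ++ β ++ a^ j ++ a^ (L ∸ j) ++ β ++ a^ ρ
          ≡⟨ cong (λ z → a^ (2 * L) ++ β ++ z) (fuse j (L ∸ j) (m+[n∸m]≡n (<⇒≤ j<L))) ⟩
        a^ (2 * L) ++ β ++ a^ L ++ β ++ a^ ρ
          ≡⟨ trans (List.++-assoc (a^ (2 * L)) _ _) (cong (a^ (2 * L) ++_) (trans (List.++-assoc β _ _)
              (cong (β ++_) (List.++-assoc (a^ L) β _)))) ⟨
        block² t ++ a^ ρ                                                          ∎
        where
        open ≡-Reasoning
        β : List A
        β = b^ (suc t)

      loop-text : ∀ (s : ℕ → List A) (F : ℕ → List Shape) (Y : ℕ → List A) n →
                  (∀ i → i < n → s i ++ concat (List.map word (F i)) ≡ Y i ++ s (suc i)) →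
                  s 0 ++ concat (List.map word (loop F n)) ≡ loop Y n ++ s n
      loop-text s F Y n e = trans (cong (λ z → s 0 ++ concat z) (map-loop word F n))
          (concat-loop s (List.map word ∘ F) Y n e)

      pass-text : ∀ ρ j → ρ < L → j < L → a^ ρ ++ concat (List.map word (pass ρ j)) ≡ u ++ a^ ρ
      pass-text ρ j ρ<L j<L = loop-text (λ _ → a^ ρ) (steps ρ j) block² q (λ t _ → steps-text ρ j ρ<L j<L t)

      period : List A
      period = u ^^ L ++ y

      round-text : ∀ ρ → ρ < L → a^ ρ ++ concat (List.map word (round ρ)) ≡ period ++ a^ (suc ρ)
      round-text ρ ρ<L = begin
        a^ ρ ++ concat (List.map word (loop (pass ρ) L ++ separator ρ))
          ≡⟨ cong (λ z → a^ ρ ++ concat z) (List.map-++ word (loop (pass ρ) L) _) ⟩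
        a^ ρ ++ concat (List.map word (loop (pass ρ) L) ++ List.map word (separator ρ))
          ≡⟨ cong (a^ ρ ++_) (List.concat-++ (List.map word (loop (pass ρ) L)) _) ⟨
        a^ ρ ++ concat (List.map word (loop (pass ρ) L)) ++ σ              ≡⟨ List.++-assoc (a^ ρ) _ _ ⟨
        (a^ ρ ++ concat (List.map word (loop (pass ρ) L))) ++ σ
          ≡⟨ cong (_++ σ) (loop-text (λ _ → a^ ρ) (pass ρ) (λ _ → u) L (λ j j<L → pass-text ρ j ρ<L j<L)) ⟩
        (loop (λ _ → u) L ++ a^ ρ) ++ σ
          ≡⟨ cong (λ z → (z ++ a^ ρ) ++ σ) (loop-const u L) ⟩
        (u ^^ L ++ a^ ρ) ++ σ                                              ≡⟨ List.++-assoc (u ^^ L) _ _ ⟩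
        u ^^ L ++ a^ ρ ++ σ                                                ≡⟨ cong (u ^^ L ++_) σ-text ⟩
        u ^^ L ++ y ++ a^ (suc ρ)                                          ≡⟨ List.++-assoc (u ^^ L) y _ ⟨
        period ++ a^ (suc ρ)                                               ∎
        where
        open ≡-Reasoning
        σ : List A
        σ = concat (List.map word (separator ρ))
        β : List A
        β = b^ (suc q)
        σ-text : a^ ρ ++ σ ≡ y ++ a^ (suc ρ)
        σ-text = begin
          a^ ρ ++ (a^ (2 * L ∸ ρ) ++ β ++ []) ++ a^ (suc (2 * L + ρ)) ++ []
            ≡⟨ cong₂ (λ z z′ → a^ ρ ++ (a^ (2 * L ∸ ρ) ++ z) ++ z′) (List.++-identityʳ β)
                (List.++-identityʳ _) ⟩
          a^ ρ ++ (a^ (2 * L ∸ ρ) ++ β) ++ a^ (suc (2 * L + ρ))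
            ≡⟨ cong (a^ ρ ++_) (List.++-assoc (a^ (2 * L ∸ ρ)) β _) ⟩
          a^ ρ ++ a^ (2 * L ∸ ρ) ++ β ++ a^ (suc (2 * L + ρ))
            ≡⟨ fuse ρ (2 * L ∸ ρ) (m+[n∸m]≡n (ρ≤2L ρ<L)) ⟩
          a^ (2 * L) ++ β ++ a^ (suc (2 * L + ρ))
            ≡⟨ cong (λ n → a^ (2 * L) ++ β ++ a^ n) (+-suc (2 * L) ρ) ⟨
          a^ (2 * L) ++ β ++ a^ (2 * L + suc ρ)
            ≡⟨ cong (λ z → a^ (2 * L) ++ β ++ z) (replicate-+ a (2 * L) (suc ρ)) ⟩
          a^ (2 * L) ++ β ++ a^ (2 * L) ++ a^ (suc ρ)
            ≡⟨ cong (a^ (2 * L) ++_) (List.++-assoc β _ _) ⟨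
          a^ (2 * L) ++ (β ++ a^ (2 * L)) ++ a^ (suc ρ)
            ≡⟨ List.++-assoc (a^ (2 * L)) _ _ ⟨
          y ++ a^ (suc ρ)                                                    ∎

      -- The final a^L is the overhang of the last round, whose run needs these letters to be
      -- complete.
      text : List A
      text = a^ (triangle (2 * L)) ++ period ^^ L ++ a^ L

      shapes-text : concat (List.map word shapes) ≡ text
      shapes-text = begin
        concat (List.map word (prelude ++ loop round L))
          ≡⟨ cong concat (List.map-++ word prelude _) ⟩
        concat (List.map word prelude ++ List.map word (loop round L))
          ≡⟨ List.concat-++ (List.map word prelude) _ ⟨
        concat (List.map word prelude) ++ concat (List.map word (loop round L))
          ≡⟨ cong₂ _++_ (prelude-text (2 * L)) (loop-text a^_ round (λ _ → period) L round-text) ⟩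
        a^ (triangle (2 * L)) ++ loop (λ _ → period) L ++ a^ L
          ≡⟨ cong (λ z → a^ (triangle (2 * L)) ++ z ++ a^ L) (loop-const period L) ⟩
        text                                                                      ∎
        where open ≡-Reasoning

  -- Small grammars for iterated words

  -- The most recently introduced nonterminal is zero.
  data Grammar (k : ℕ) : ℕ → Set where
    []  : Grammar k 0
    _▸_ : Grammar k N → List⁺ (Symbol k N) → Grammar k (suc N)

  lift : Symbol k N → Symbol k (suc N)
  lift = Sum.map₁ suc

  rules : Grammar k N → Rules k N
  rules []      = []
  rules (G ▸ e) = List⁺.map lift e ∷ Vec.map (List⁺.map lift) (rules G)

  grammarSize : Grammar k N → ℕ
  grammarSize []      = 0
  grammarSize (G ▸ e) = List⁺.length e + grammarSize G

  length-lift : (e : List⁺ (Symbol k N)) → List⁺.length (List⁺.map (lift {k} {N}) e) ≡ List⁺.length e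
  length-lift (_ ∷ e) = cong suc (List.length-map lift e)

  sum-rules : (G : Grammar k N) → Vec.sum (Vec.map List⁺.length (rules G)) ≡ grammarSize G
  sum-rules []      = refl
  sum-rules (G ▸ e) = cong₂ _+_ (length-lift e) (trans (sum-lift (rules G)) (sum-rules G))
    where
    sum-lift : ∀ {n} (R : Vec (List⁺ (Symbol k N)) n) →
               Vec.sum (Vec.map List⁺.length (Vec.map (List⁺.map lift) R)) ≡ Vec.sum (Vec.map List⁺.length R)
    sum-lift []      = refl
    sum-lift (e ∷ R) = cong₂ _+_ (length-lift e) (sum-lift R)

  rhs-lift : ∀ (G : Grammar k N) e A → rhs (rules (G ▸ e)) (suc A) ≡ List.map lift (rhs (rules G) A)
  rhs-lift G e A = cong List⁺.toList (Vec.lookup-map A (List⁺.map lift) (rules G))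

  uses-increases : ∀ (G : Grammar k N) {A B} → Uses (rules G) A B → toℕ A < toℕ B
  uses-increases (G ▸ e) {zero} u with ∈-map⁻ lift {xs = List⁺.toList e} u
  ... | inj₁ _ , _ , refl = s≤s z≤n
  uses-increases (G ▸ e) {suc A} {B} u with ∈-map⁻ lift {xs = rhs (rules G) A}
      (subst (inj₁ B ∈_) (rhs-lift G e A) u)
  ... | inj₁ _ , u′ , refl = s≤s (uses-increases G u′)

  grammar-acyclic : (G : Grammar k N) → Acyclic (rules G)
  grammar-acyclic {N = N} G = rank⇒acyclic (rules G) (λ A → N ∸ toℕ A)
    λ {A} {B} u → ∸-monoʳ-< (uses-increases G u) (<⇒≤ (Fin.toℕ<n B))

  module _ (G : Grammar k N) (e : List⁺ (Symbol k N)) where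
    mutual
      weaken : ∀ {s u} → rules G ⊢ s ⇒ u → rules (G ▸ e) ⊢ lift s ⇒ u
      weaken term             = term
      weaken (rule {A} {u} d) = rule (subst (rules (G ▸ e) ⊢_⇒* u) (sym (rhs-lift G e A)) (weaken* d))

      weaken* : ∀ {ss u} → rules G ⊢ ss ⇒* u → rules (G ▸ e) ⊢ List.map lift ss ⇒* u
      weaken* []       = []
      weaken* (d ∷ ds) = weaken d ∷ weaken* ds

  -- What has been built is named by words instead of symbols, so that a new rule, which renumbers
  -- the nonterminals, leaves `E` untouched. Letters are derived by terminals and cost nothing.
  record Generates (E : List (List (Fin k))) (c : ℕ) : Set where
    constructor generates
    field
      {#N}    : ℕ
      grammar : Grammar k #N
      size≤   : grammarSize grammar ≤ c
      derived : All (λ u → ∃ λ s → rules grammar ⊢ s ⇒ u) E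

  Generates-⊆ : ∀ {E E′ : List (List (Fin k))} {c} → (∀ {x} → x ∈ E′ → x ∈ E) → Generates E c → Generates E′ c
  Generates-⊆ sub (generates G le d) = generates G le (All.tabulate (All.lookup d ∘ sub))

  Generates-≤ : ∀ {E : List (List (Fin k))} {c c′} → c ≤ c′ → Generates E c → Generates E c′
  Generates-≤ le′ (generates G le d) = generates G (≤-trans le le′) d

  generate-letters : ∀ {E : List (List (Fin k))} → All (λ u → ∃ λ a → u ≡ List.[ a ]) E → Generates E 0
  generate-letters ls = generates [] z≤n (All.map (λ { (a , refl) → inj₂ a , term }) ls)

  -- The new nonterminal is exposed because `generated-SLP` needs one as its start, whereas
  -- `Generates` only records that some symbol derives each word.
  define : ∀ {E : List (List (Fin k))} {c} us → 1 ≤ length us → All (_∈ E) us → Generates E c →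
           ∃₂ λ N (G : Grammar k (suc N)) → grammarSize G ≤ length us + c ×
           rules G ⊢ inj₁ zero ⇒ concat us × All (λ u → ∃ λ s → rules G ⊢ s ⇒ u) E
  define {k} {E} us 1≤ us∈ (generates {N} G le d) with spell us us∈
    where
    spell : ∀ us → All (_∈ E) us → ∃ λ ss → rules G ⊢ ss ⇒* concat us × length ss ≡ length us
    spell []       []         = [] , [] , refl
    spell (u ∷ us) (u∈ ∷ us∈) with All.lookup d u∈ | spell us us∈
    ... | s , du | ss , ds , e = s ∷ ss , du ∷ ds , cong suc e
  ... | []     , _  , e = contradiction (≤-trans 1≤ (≤-reflexive (sym e))) λ ()
  ... | s ∷ ss , ds , e = N , G ▸ (s ∷ ss) , +-mono-≤ (≤-reflexive e) le ,
    rule (weaken* G (s ∷ ss) ds) , All.map (λ (s′ , d′) → lift s′ , weaken G (s ∷ ss) d′) d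

  generate-concat : ∀ {E : List (List (Fin k))} {c} us → 1 ≤ length us → All (_∈ E) us → Generates E c →
                    Generates (concat us ∷ E) (length us + c)
  generate-concat us 1≤ us∈ g with define us 1≤ us∈ g
  ... | _ , G , le , d , ds = generates G le ((_ , d) ∷ ds)

  generated-SLP : ∀ {E : List (List (Fin k))} {c} us → 1 ≤ length us → All (_∈ E) us → Generates E c →
                  ∃ λ (𝔸 : SLP k) → val 𝔸 ≡ concat us × size 𝔸 ≤ length us + c
  generated-SLP us 1≤ us∈ g with define us 1≤ us∈ g
  ... | _ , G , le , d , _ =
    let 𝔸 = record { rules = rules G ; start = zero ; acyclic = grammar-acyclic G } in
    𝔸 , val-unique 𝔸 d , ≤-trans (≤-reflexive (sum-rules G)) le

  halve : ∀ n → ∃ λ h → n ≡ h + h ⊎ n ≡ suc (h + h)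
  halve zero    = 0 , inj₁ refl
  halve (suc n) with halve n
  ... | h , inj₁ e = h , inj₂ (cong suc e)
  ... | h , inj₂ e = suc h , inj₁ (cong suc (trans e (sym (+-suc h h))))

  replace : ∀ {E : List (List (Fin k))} {c c′ u v w} → w ≡ v → c ≤ c′ →
            Generates (w ∷ u ∷ E) c → Generates (v ∷ E) c′
  replace refl le g = Generates-≤ le (Generates-⊆ (λ { (here e) → here e ; (there p) → there (there p) }) g)

  -- Repeated squaring: each binary digit of the exponent costs at most three symbols.
  generate-power : ∀ {E : List (List (Fin k))} {c u} e n → 1 ≤ n → n < 2 ^ e → u ∈ E → Generates E c →
                   Generates (u ^^ n ∷ E) (3 * e + c)
  generate-power zero    n 1≤n n<1 u∈ g = contradiction (≤-trans (s≤s 1≤n) n<1) λ { (s≤s ()) }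
  generate-power {k} {E} {c} {u} (suc e) n 1≤n n<2^ u∈ g with halve n
  ... | zero , inj₁ refl = contradiction 1≤n λ ()
  ... | zero , inj₂ refl = Generates-≤ (m≤n+m c _)
    (Generates-⊆ (λ { (here refl) → subst (_∈ E) (sym (List.++-identityʳ u)) u∈ ; (there p) → p }) g)
  ... | h@(suc _) , inj₁ refl = replace square (≤-trans (n≤1+n _) (≤-reflexive (cost e c)))
    (generate-concat (u ^^ h ∷ u ^^ h ∷ []) (s≤s z≤n) (here refl ∷ here refl ∷ [])
      (generate-power e h (s≤s z≤n) h<2^e u∈ g))
    where
    cost : ∀ e c → 3 + (3 * e + c) ≡ 3 * suc e + c
    cost = solve-∀
    h<2^e : h < 2 ^ e
    h<2^e = *-cancelˡ-< 2 _ _ (subst (_< 2 * 2 ^ e) (cong (h +_) (sym (+-identityʳ h))) n<2^)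
    square : u ^^ h ++ u ^^ h ++ [] ≡ u ^^ (h + h)
    square = trans (cong (u ^^ h ++_) (List.++-identityʳ _)) (sym (^^-+ u h h))
  ... | h@(suc _) , inj₂ refl = replace square (≤-reflexive (cost e c))
    (generate-concat (u ∷ u ^^ h ∷ u ^^ h ∷ []) (s≤s z≤n) (there u∈ ∷ here refl ∷ here refl ∷ [])
      (generate-power e h (s≤s z≤n) h<2^e u∈ g))
    where
    cost : ∀ e c → 3 + (3 * e + c) ≡ 3 * suc e + c
    cost = solve-∀
    h<2^e : h < 2 ^ e
    h<2^e = *-cancelˡ-< 2 _ _ (<-trans (subst (_< suc (h + h)) (cong (h +_) (sym (+-identityʳ h))) ≤-refl) n<2^)
    square : u ++ u ^^ h ++ u ^^ h ++ [] ≡ u ^^ suc (h + h)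
    square = cong (u ++_) (trans (cong (u ^^ h ++_) (List.++-identityʳ _)) (sym (^^-+ u h h)))

  ^^-replicate : ∀ {A : Set} (c : A) n → List.[ c ] ^^ n ≡ replicate n c
  ^^-replicate c zero    = refl
  ^^-replicate c (suc n) = cong (c ∷_) (^^-replicate c n)

  length-replicate-++ : ∀ {A : Set} m {c : A} xs → length (replicate m c ++ xs) ≡ m + length xs
  length-replicate-++ m {c} xs = trans (List.length-++ (replicate m c))
      (cong (_+ length xs) (List.length-replicate m))

  -- Six powers cost 3e each: four runs of a, the power of `u` and the power of the period. The runs
  -- of b cost 2(q + 1), `u` costs 4q, the period 4 and the start rule 3.
  total-cost : ∀ e q → 3 + (3 * e +
      (4 + (3 * e + (q * 4 + (3 * e + (3 * e + (3 * e + (3 * e + suc q * 2)))))))) ≡ 18 * e + 6 * q + 9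
  total-cost = solve-∀

  module Generation {k : ℕ} (a b : Fin k) where
    infix 9 a^_ b^_
    a^_ b^_ : ℕ → List (Fin k)
    a^ n = replicate n a
    b^ n = replicate n b

    runs : ℕ → List (List (Fin k))
    runs zero    = []
    runs (suc n) = b^ (suc n) ∷ runs n

    b-run∈ : ∀ {n t} → t < n → b^ (suc t) ∈ runs n
    b-run∈ {suc n} {t} t<n with m≤n⇒m<n∨m≡n t<n
    ... | inj₁ (s≤s t<n′) = there (b-run∈ t<n′)
    ... | inj₂ refl       = here refl

    letters : List (List (Fin k))
    letters = List.[ a ] ∷ List.[ b ] ∷ []

    subst-head : ∀ {E c u v} → u ≡ v → Generates {k} (u ∷ E) c → Generates (v ∷ E) c
    subst-head refl g = g

    -- All these runs are needed anyway, so each is obtained from its predecessor by one letter,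
    -- which keeps the total linear in `n`.
    generate-runs : ∀ n → Generates (runs n ++ letters) (n * 2)
    generate-runs zero          = generate-letters ((a , refl) ∷ (b , refl) ∷ [])
    generate-runs (suc zero)    = Generates-≤ (s≤s z≤n)
      (generate-concat (List.[ b ] ∷ []) (s≤s z≤n) (there (here refl) ∷ []) (generate-runs zero))
    generate-runs (suc (suc n)) = subst-head (sym (replicate-snoc b (suc n)))
      (generate-concat (b^ (suc n) ∷ List.[ b ] ∷ []) (s≤s z≤n)
        (here refl ∷ ∈-++⁺ʳ (runs (suc n)) (there (here refl)) ∷ []) (generate-runs (suc n)))

    generate-a^ : ∀ {E c} e n → 1 ≤ n → n < 2 ^ e → List.[ a ] ∈ E → Generates E c → Generates (a^ n ∷ E)
        (3 * e + c)
    generate-a^ e n 1≤n n<2^e a∈ g = subst-head (^^-replicate a n) (generate-power e n 1≤n n<2^e a∈ g)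

    module _ (D L q : ℕ) where

      pieces : ℕ → List (List (Fin k))
      pieces t = a^ D ∷ b^ (suc t) ∷ a^ L ∷ b^ (suc t) ∷ []

      u y : List (Fin k)
      u = loop (λ t → a^ D ++ b^ (suc t) ++ a^ L ++ b^ (suc t)) q
      y = a^ D ++ b^ (suc q) ++ a^ D

      pieces-text : concat (loop pieces q) ≡ u
      pieces-text = trans (concat-loop (λ _ → []) pieces _ q (λ t _ →
        trans (cong (λ z → a^ D ++ b^ (suc t) ++ a^ L ++ z) (List.++-identityʳ _))
            (sym (List.++-identityʳ _)))) (List.++-identityʳ u)

      -- In the application `D` is 2L, `T` the triangular exponent of the prelude and `P` the
      -- exponent of the final run including padding.
      module _ (T P e : ℕ) (1≤L : 1 ≤ L) (1≤D : 1 ≤ D) (1≤T : 1 ≤ T) (1≤P : 1 ≤ P) (1≤q : 1 ≤ q)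
               (L<2^e : L < 2 ^ e) (D<2^e : D < 2 ^ e) (T<2^e : T < 2 ^ e) (P<2^e : P < 2 ^ e) where

        private
          base : List (List (Fin k))
          base = a^ P ∷ a^ T ∷ a^ D ∷ a^ L ∷ runs (suc q) ++ letters

          cost : ℕ
          cost = 3 * e + (3 * e + (3 * e + (3 * e + suc q * 2)))

          a∈ : List.[ a ] ∈ runs (suc q) ++ letters
          a∈ = ∈-++⁺ʳ (runs (suc q)) (here refl)

          generate-base : Generates base cost
          generate-base =
            generate-a^ e P 1≤P P<2^e (there (there (there a∈)))
            (generate-a^ e T 1≤T T<2^e (there (there a∈))
            (generate-a^ e D 1≤D D<2^e (there a∈)
            (generate-a^ e L 1≤L L<2^e a∈
            (generate-runs (suc q)))))

          run∈base : ∀ {t} → t < suc q → b^ (suc t) ∈ base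
          run∈base t<q = there (there (there (there (∈-++⁺ˡ (b-run∈ t<q)))))

          pieces∈ : All (_∈ base) (loop pieces q)
          pieces∈ = All.tabulate λ x∈ → go (∈-loop⁻ pieces q x∈)
            where
            go : ∀ {x} → (∃ λ t → t < q × x ∈ pieces t) → x ∈ base
            go (t , t<q , here refl)                         = there (there (here refl))
            go (t , t<q , there (here refl))                 = run∈base (m<n⇒m<1+n t<q)
            go (t , t<q , there (there (here refl)))         = there (there (there (here refl)))
            go (t , t<q , there (there (there (here refl)))) = run∈base (m<n⇒m<1+n t<q)

          generate-u : Generates (u ∷ base) (q * 4 + cost)
          generate-u = Generates-≤ (+-monoˡ-≤ cost (length-loop pieces q 4 (λ _ _ → ≤-refl)))
            (subst-head pieces-text (generate-concat (loop pieces q)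
              (≤-trans (≤-trans 1≤q (m≤m*n q 1)) (length-loop≥ pieces q 1 (λ _ → s≤s z≤n))) pieces∈
                  generate-base))

          generate-period : Generates ((u ^^ L ++ y) ∷ u ^^ L ∷ u ∷ base) (4 + (3 * e + (q * 4 + cost)))
          generate-period = subst-head (cong (λ z → u ^^ L ++ a^ D ++ b^ (suc q) ++ z)
              (List.++-identityʳ (a^ D)))
            (generate-concat (u ^^ L ∷ a^ D ∷ b^ (suc q) ∷ a^ D ∷ []) (s≤s z≤n)
              (here refl ∷ there (there (there (there (here refl)))) ∷ there (there (run∈base ≤-refl)) ∷
                  there (there (there (there (here refl)))) ∷ [])
              (generate-power e L 1≤L L<2^e (here refl) generate-u))

          environment : List (List (Fin k))
          environment = (u ^^ L ++ y) ^^ L ∷ (u ^^ L ++ y) ∷ u ^^ L ∷ u ∷ base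

          generate-environment : Generates environment (3 * e + (4 + (3 * e + (q * 4 + cost))))
          generate-environment = generate-power e L 1≤L L<2^e (here refl) generate-period

          parts∈ : All (_∈ environment) (a^ T ∷ (u ^^ L ++ y) ^^ L ∷ a^ P ∷ [])
          parts∈ = there (there (there (there (there (here refl))))) ∷ here refl ∷ there
              (there (there (there (here refl)))) ∷ []

        text-SLP : ∃ λ (𝔸 : SLP k) → val 𝔸 ≡ a^ T ++ (u ^^ L ++ y) ^^ L ++ a^ P × size 𝔸 ≤ 18 * e + 6 * q + 9
        text-SLP = finish (generated-SLP _ (s≤s z≤n) parts∈ generate-environment)
          where
          finish : (∃ λ (𝔸 : SLP k) → val 𝔸 ≡ a^ T ++ (u ^^ L ++ y) ^^ L ++ a^ P ++ [] × size 𝔸 ≤ 3 +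
              (3 * e + (4 + (3 * e + (q * 4 + cost))))) →
                   ∃ λ (𝔸 : SLP k) → val 𝔸 ≡ a^ T ++ (u ^^ L ++ y) ^^ L ++ a^ P × size 𝔸 ≤ 18 * e + 6 * q + 9
          finish (𝔸 , v , le) = 𝔸 , trans v (cong (λ z → a^ T ++ (u ^^ L ++ y) ^^ L ++ z)
              (List.++-identityʳ (a^ P))) ,
            ≤-trans le (≤-reflexive (total-cost e q))

  -- Length and grammar size of the padded text.

  module Compressed {k : ℕ} (a b : Fin k) (a≢b : a ≢ b) (L′ q′ : ℕ) where
    open Parse L′ q′
    open Text a b a≢b

    triangle≥ : ∀ n → n ≤ triangle n
    triangle≥ zero    = z≤n
    triangle≥ (suc n) = m≤n+m (suc n) (triangle n)

    triangle≤ : ∀ n → triangle n ≤ n * n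
    triangle≤ zero    = z≤n
    triangle≤ (suc n) = begin
      triangle n + suc n  ≤⟨ +-monoˡ-≤ (suc n) (triangle≤ n) ⟩
      n * n + suc n       ≡⟨ +-comm (n * n) (suc n) ⟩
      suc n + n * n       ≤⟨ +-monoʳ-≤ (suc n) (*-monoʳ-≤ n (n≤1+n n)) ⟩
      suc n + n * suc n   ∎
      where open ≤-Reasoning

    length-u : length u ≤ q * (3 * L + 2 * q)
    length-u = length-loop block² q (3 * L + 2 * q) λ t t<q → begin
      length (block² t)
        ≡⟨ trans (length-replicate-++ (2 * L) _) (cong (2 * L +_) (trans (length-replicate-++ (suc t) _)
            (cong (suc t +_) (trans (length-replicate-++ L _)
            (cong (L +_) (List.length-replicate (suc t))))))) ⟩
      2 * L + (suc t + (L + suc t))                 ≡⟨ lem L (suc t) ⟩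
      3 * L + 2 * suc t                             ≤⟨ +-monoʳ-≤ (3 * L) (*-monoʳ-≤ 2 t<q) ⟩
      3 * L + 2 * q                                 ∎
      where
      open ≤-Reasoning
      lem : ∀ L t → 2 * L + (t + (L + t)) ≡ 3 * L + 2 * t
      lem = solve-∀

    length-y : length y ≡ 2 * L + (suc q + 2 * L)
    length-y = trans (length-replicate-++ (2 * L) _) (cong (2 * L +_) (trans (length-replicate-++ (suc q) _)
        (cong (suc q +_) (List.length-replicate (2 * L)))))

    length-text : length text ≡ triangle (2 * L) + (L * (L * length u + length y) + L)
    length-text = begin
      length text
        ≡⟨ length-replicate-++ (triangle (2 * L)) _ ⟩
      triangle (2 * L) + length (period ^^ L ++ a^ L)
        ≡⟨ cong (triangle (2 * L) +_) (List.length-++ (period ^^ L)) ⟩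
      triangle (2 * L) + (length (period ^^ L) + length (a^ L))
        ≡⟨ cong₂ (λ m n → triangle (2 * L) + (m + n)) (length-^^ period L) (List.length-replicate L) ⟩
      triangle (2 * L) + (L * length period + L)
        ≡⟨ cong (λ m → triangle (2 * L) + (L * m + L)) (trans (List.length-++ (u ^^ L))
            (cong (_+ length y) (length-^^ u L))) ⟩
      triangle (2 * L) + (L * (L * length u + length y) + L)            ∎
      where open ≡-Reasoning

    -- With q ≤ L the runs of b are no longer than those of a up to a constant, so `u` has length at
    -- most 5 q L and its L² copies give 5 q L³. Prelude, separators and final run add 4 + 6 + 1 =
    -- 11 times L².
    length-text≤ : q ≤ L → length text ≤ 16 * q * (L * L * L)
    length-text≤ q≤L = begin
      length text                                                               ≡⟨ length-text ⟩
      triangle (2 * L) + (L * (L * length u + length y) + L)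
        ≤⟨ +-mono-≤ (triangle≤ (2 * L)) (+-mono-≤ (*-monoʳ-≤ L (+-mono-≤ (*-monoʳ-≤ L length-u′) length-y′))
            L≤) ⟩
      2 * L * (2 * L) + (L * (L * (q * (5 * L)) + 6 * L) + L * L)               ≡⟨ lem₁ L q ⟩
      11 * (1 * (L * L)) + 5 * q * (L * L * L)
        ≤⟨ +-monoˡ-≤ _ (*-monoʳ-≤ 11 (*-mono-≤ (s≤s {0} {q′} z≤n) (m≤m*n (L * L) L))) ⟩
      11 * (q * (L * L * L)) + 5 * q * (L * L * L)                              ≡⟨ lem₂ q (L * L * L) ⟩
      16 * q * (L * L * L)                                                      ∎
      where
      open ≤-Reasoning
      lem₁ : ∀ L q → 2 * L * (2 * L) + (L * (L * (q * (5 * L)) + 6 * L) + L * L) ≡ 11 * (1 * (L * L)) + 5 *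
          q * (L * L * L)
      lem₁ = solve-∀
      lem₂ : ∀ q x → 11 * (q * x) + 5 * q * x ≡ 16 * q * x
      lem₂ = solve-∀
      lem₃ : ∀ L → 3 * L + 2 * L ≡ 5 * L
      lem₃ = solve-∀
      lem₄ : ∀ L → 2 * L + (L + L + 2 * L) ≡ 6 * L
      lem₄ = solve-∀
      L≤ : L ≤ L * L
      L≤ = m≤m*n L L
      length-u′ : length u ≤ q * (5 * L)
      length-u′ = ≤-trans length-u (*-monoʳ-≤ q (≤-trans (+-monoʳ-≤ (3 * L) (*-monoʳ-≤ 2 q≤L))
          (≤-reflexive (lem₃ L))))
      length-y′ : length y ≤ 6 * L
      length-y′ = ≤-trans (≤-reflexive length-y)
          (≤-trans (+-monoʳ-≤ (2 * L) (+-monoˡ-≤ (2 * L) (+-mono-≤ (s≤s {0} {L′} z≤n) q≤L)))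
          (≤-reflexive (lem₄ L)))

    -- Padding reaches every length exactly. It only lengthens the final run of a, so the grammar
    -- keeps its form.
    paddedText : ℕ → List (Fin k)
    paddedText p = text ++ a^ p

    text-split : ∀ p → a^ (triangle (2 * L)) ++ period ^^ L ++ a^ (L + p) ≡ paddedText p
    text-split p = begin
      a^ (triangle (2 * L)) ++ period ^^ L ++ a^ (L + p)
        ≡⟨ cong (λ z → a^ (triangle (2 * L)) ++ period ^^ L ++ z) (replicate-+ a L p) ⟩
      a^ (triangle (2 * L)) ++ period ^^ L ++ a^ L ++ a^ p
        ≡⟨ cong (a^ (triangle (2 * L)) ++_) (List.++-assoc (period ^^ L) _ _) ⟨
      a^ (triangle (2 * L)) ++ (period ^^ L ++ a^ L) ++ a^ p   ≡⟨ List.++-assoc (a^ (triangle (2 * L))) _ _ ⟨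
      (a^ (triangle (2 * L)) ++ period ^^ L ++ a^ L) ++ a^ p   ∎
      where open ≡-Reasoning

    module _ (p e : ℕ) (bound : length text + p < 2 ^ e) where
      private
        2L≤tri : 2 * L ≤ triangle (2 * L)
        2L≤tri = triangle≥ (2 * L)
        tri≤ : triangle (2 * L) ≤ length text + p
        tri≤ = ≤-trans (≤-trans (m≤m+n _ _) (≤-reflexive (sym length-text))) (m≤m+n _ p)
        2L<2^e : 2 * L < 2 ^ e
        2L<2^e = ≤-<-trans (≤-trans 2L≤tri tri≤) bound
        L<2^e : L < 2 ^ e
        L<2^e = ≤-<-trans (m≤m+n L _) 2L<2^e
        L≤text : L ≤ length text
        L≤text = ≤-trans (≤-trans (m≤n+m L (L * (L * length u + length y))) (m≤n+m _ (triangle (2 * L))))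
            (≤-reflexive (sym length-text))
        L+p<2^e : L + p < 2 ^ e
        L+p<2^e = ≤-<-trans (+-monoˡ-≤ p L≤text) bound
        1≤tri : 1 ≤ triangle (2 * L)
        1≤tri = ≤-trans (s≤s z≤n) 2L≤tri

      -- No exponent exceeds the total length, so a single number `e` of binary digits serves all
      -- six powers.
      paddedText-SLP : ∃ λ (𝔸 : SLP k) → val 𝔸 ≡ paddedText p × size 𝔸 ≤ 18 * e + 6 * q + 9
      paddedText-SLP = let 𝔸 , v , le = generated in 𝔸 , trans v (text-split p) , le
        where
        generated : ∃ λ (𝔸 : SLP k) → val 𝔸 ≡ a^ (triangle (2 * L)) ++ period ^^ L ++ a^ (L + p) × size 𝔸 ≤
            18 * e + 6 * q + 9
        generated = Generation.text-SLP a b (2 * L) L q (triangle (2 * L)) (L + p) e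
          (s≤s z≤n) (s≤s z≤n) 1≤tri (s≤s z≤n) (s≤s z≤n) L<2^e 2L<2^e (≤-<-trans tri≤ bound) L+p<2^e

  -- Bounds on the LZ78 grammar in terms of the length and of the smallest grammar

  |lz78| : Word k → ℕ
  |lz78| w = size (compress LZ78 w)

  g≤ : ∀ (w : Word k) 𝔸 → val 𝔸 ≡ List⁺.toList w → g w ≤ size 𝔸
  g≤ w 𝔸 e = proj₂ (proj₂ (smallest w)) (size 𝔸) (𝔸 , e , refl)

  word∈words : ∀ {n} (w : Word k) → List⁺.length w ≡ suc n → w ∈ words k (suc n)
  word∈words {k} (x ∷ xs) refl = subst (_∈ words k (suc (length xs))) (cong (x ∷_) (Vec.toList∘fromList xs))
    (∈-map⁺ List⁺.fromVec (∈-vecs {v = x ∷ Vec.fromList xs} (VecAll.universal ∈-allFin _)))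

  ∈words-length : ∀ {n} {w : Word k} → w ∈ words k n → List⁺.length w ≡ n
  ∈words-length {k} {suc n} w∈ with ∈-map⁻ List⁺.fromVec w∈
  ... | x ∷ xs , _ , refl = cong suc (Vec.length-toList xs)

  n≤2^g : ∀ (w : Word k) → List⁺.length w ≤ 2 ^ g w
  n≤2^g w with proj₁ (proj₂ (smallest w))
  ... | 𝔸 , v , s = subst₂ (λ u m → length u ≤ 2 ^ m) v s (length-val 𝔸)

  -- 512 is 4³ · 8, with at most four grammar symbols per factor.
  |lz78|³≤ : ∀ (w : Word k) → let n = List⁺.length w in
             |lz78| w * |lz78| w * |lz78| w ≤ 512 * g w * (n * n)
  |lz78|³≤ w with proj₁ (proj₂ (smallest w))
  ... | 𝔸 , v , s = begin
    |lz78| w * |lz78| w * |lz78| w    ≤⟨ *-mono-≤ (*-mono-≤ ≤4m ≤4m) ≤4m ⟩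
    4 * m * (4 * m) * (4 * m)         ≡⟨ lem₁ m ⟩
    64 * (m * m * m)                  ≤⟨ *-monoʳ-≤ 64 (m³≤8gn² F 𝔸 v) ⟩
    64 * (8 * size 𝔸 * (n * n))       ≡⟨ cong (λ γ → 64 * (8 * γ * (n * n))) s ⟩
    64 * (8 * g w * (n * n))          ≡⟨ lem₂ (g w) (n * n) ⟩
    512 * g w * (n * n)               ∎
    where
    open ≤-Reasoning
    F : Factorization (List⁺.toList w)
    F = factorize (List⁺.toList w)
    n : ℕ
    n = List⁺.length w
    m : ℕ
    m = Factorization.m F
    ≤4m : |lz78| w ≤ 4 * m
    ≤4m = size-lz78≤4m F (λ ())
    lem₁ : ∀ m → 4 * m * (4 * m) * (4 * m) ≡ 64 * (m * m * m)
    lem₁ = solve-∀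
    lem₂ : ∀ γ x → 64 * (8 * γ * x) ≡ 512 * γ * x
    lem₂ = solve-∀

  -- Needed to derive q ≤ L from the choice of `L`, and the origin of the threshold 2²²: the
  -- inequality fails at 21, where 16 · 21⁴ = 3111696 exceeds 2²¹ = 2097152.
  16q⁴≤2^q : ∀ d → let q = d + 22 in 16 * q * (q * q * q) ≤ 2 ^ q
  16q⁴≤2^q zero    = ≤ᵇ⇒≤ _ _ _
  16q⁴≤2^q (suc d) = begin
    16 * suc q * (suc q * suc q * suc q)                            ≡⟨ lem₁ q ⟩
    -- The lower binomial terms are at most (4 + 6 + 4 + 1) q³ = 15 q³ ≤ q⁴.
    16 * (q * q * q * q) + 16 * (4 * (q * q * q) + 6 * (q * q) * 1 + 4 * q * 1 * 1 + 1 * 1 * 1)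
      ≤⟨ +-monoʳ-≤ (16 * (q * q * q * q))
          (*-monoʳ-≤ 16 (+-mono-≤ (+-mono-≤ (+-monoʳ-≤ (4 * (q * q * q)) (*-monoʳ-≤ (6 * (q * q)) 1≤q))
          (*-mono-≤ (*-monoʳ-≤ (4 * q) 1≤q) 1≤q)) (*-mono-≤ (*-mono-≤ 1≤q 1≤q) 1≤q))) ⟩
    16 * (q * q * q * q) + 16 * (4 * (q * q * q) + 6 * (q * q) * q + 4 * q * q * q + q * q * q) ≡⟨ lem₂ q ⟩
    16 * (q * q * q * q) + 16 * (15 * (q * q * q))
      ≤⟨ +-monoʳ-≤ (16 * (q * q * q * q)) (*-monoʳ-≤ 16 (*-monoˡ-≤ (q * q * q) 15≤q)) ⟩
    16 * (q * q * q * q) + 16 * (q * (q * q * q))                   ≡⟨ lem₃ q ⟩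
    2 * (16 * q * (q * q * q))                                      ≤⟨ *-monoʳ-≤ 2 (16q⁴≤2^q d) ⟩
    2 * 2 ^ q                                                       ∎
    where
    open ≤-Reasoning
    q : ℕ
    q = d + 22
    15≤q : 15 ≤ q
    15≤q = ≤-trans (≤ᵇ⇒≤ 15 22 _) (m≤n+m 22 d)
    1≤q : 1 ≤ q
    1≤q = ≤-trans (≤ᵇ⇒≤ 1 22 _) (m≤n+m 22 d)
    lem₁ : ∀ q → 16 * suc q * (suc q * suc q * suc q) ≡ 16 * (q * q * q * q) + 16 *
        (4 * (q * q * q) + 6 * (q * q) * 1 + 4 * q * 1 * 1 + 1 * 1 * 1)
    lem₁ = solve-∀
    lem₂ : ∀ q → 16 * (q * q * q * q) + 16 * (4 * (q * q * q) + 6 * (q * q) * q + 4 * q * q * q + q * q * q)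
        ≡ 16 * (q * q * q * q) + 16 * (15 * (q * q * q))
    lem₂ = solve-∀
    lem₃ : ∀ q → 16 * (q * q * q * q) + 16 * (q * (q * q * q)) ≡ 2 * (16 * q * (q * q * q))
    lem₃ = solve-∀

  -- q = ⌊log₂ n⌋, and L is maximal with 16 q L³ ≤ n, which bounds the length of the text.
  parameters : ∀ n → 2 ^ 22 ≤ n → ∃₂ λ L′ q′ → let L = suc L′ ; q = suc q′ in
               q ≤ L × 2 ^ q ≤ n × n < 2 ^ suc q ×
               16 * q * (L * L * L) ≤ n × n ≤ 128 * q * (L * L * L)
  parameters n n₀≤n with crossover (2 ^_) (suc n) (≤-trans (m^n>0 2 22) n₀≤n) (n≤2^n (suc n))
  ... | q , 2^q≤n , n<2^1+q = search q 22≤q 2^q≤n n<2^1+q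
    where
    22≤q : 22 ≤ q
    22≤q = ≮⇒≥ λ q<22 → <⇒≱ n<2^1+q (≤-trans (^-monoʳ-≤ 2 q<22) n₀≤n)
    search : ∀ q → 22 ≤ q → 2 ^ q ≤ n → n < 2 ^ suc q → _
    search zero ()
    search q@(suc q′) 22≤q 2^q≤n n<2^1+q
      with crossover (λ L → 16 * q * (L * L * L)) (suc n)
             (≤-trans (≤-reflexive (*-zeroʳ (16 * q))) z≤n)
             (≤-trans (≤-trans (m≤m*n (suc n) (suc n)) (m≤m*n (suc n * suc n) (suc n)))
                 (m≤n*m (suc n * suc n * suc n) (16 * q)))
    ... | L , fL≤n , n<fL⁺ = done L q≤L fL≤n n<fL⁺
      where
      q≤L : q ≤ L
      q≤L = ≮⇒≥ λ L<q → <⇒≱ n<fL⁺ (begin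
        16 * q * (suc L * suc L * suc L)   ≤⟨ *-monoʳ-≤ (16 * q) (*-mono-≤ (*-mono-≤ L<q L<q) L<q) ⟩
        16 * q * (q * q * q)
          ≤⟨ subst (λ q → 16 * q * (q * q * q) ≤ 2 ^ q) (m∸n+n≡m 22≤q) (16q⁴≤2^q (q ∸ 22)) ⟩
        2 ^ q                              ≤⟨ 2^q≤n ⟩
        n                                  ∎)
        where open ≤-Reasoning
      done : ∀ L → q ≤ L → 16 * q * (L * L * L) ≤ n → n < 16 * q * (suc L * suc L * suc L) → _
      done (suc L′) q≤L fL≤n n<fL⁺ = L′ , q′ , q≤L , 2^q≤n , n<2^1+q , fL≤n , (begin
        n                                             ≤⟨ <⇒≤ n<fL⁺ ⟩
        16 * q * (suc l * suc l * suc l)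
          ≤⟨ *-monoʳ-≤ (16 * q) (*-mono-≤ (*-mono-≤ 1+l≤2l 1+l≤2l) 1+l≤2l) ⟩
        16 * q * (2 * l * (2 * l) * (2 * l))          ≡⟨ lem q l ⟩
        128 * q * (l * l * l)                         ∎)
        where
        open ≤-Reasoning
        l : ℕ
        l = suc L′
        1+l≤2l : suc l ≤ 2 * l
        1+l≤2l = +-mono-≤ (s≤s z≤n) (≤-reflexive (sym (+-identityʳ l)))
        lem : ∀ q l → 16 * q * (2 * l * (2 * l) * (2 * l)) ≡ 128 * q * (l * l * l)
        lem = solve-∀

  record Witness (k n : ℕ) : Set where
    field
      q L      : ℕ
      2^q≤n    : 2 ^ q ≤ n
      n≤128qL³ : n ≤ 128 * q * (L * L * L)
      w        : Word k
      w∈       : w ∈ words k n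
      lz78≥    : L * (L * (q * 2)) ≤ |lz78| w
      smallest≤ : g w ≤ 51 * q

  witness : ∀ k n → 2 ≤ k → 2 ^ 22 ≤ n → Witness k n
  witness (suc zero)    n (s≤s ()) _
  witness (suc (suc k)) n 2≤k n₀≤n with parameters n n₀≤n
  witness (suc (suc k)) n 2≤k n₀≤n | L′ , q′ , q≤L , 2^q≤n , n<2^1+q , text≤n , n≤ = record
    { q = q ; L = L ; 2^q≤n = 2^q≤n ; n≤128qL³ = n≤
    ; w = w ; w∈ = w∈ ; lz78≥ = lz78≥ ; smallest≤ = smallest≤ }
    where
    a b : Fin (suc (suc k))
    a = zero
    b = suc zero
    a≢b : a ≢ b
    a≢b ()
    open Parse L′ q′
    open Text a b a≢b
    open Words a b a≢b
    open Compressed a b a≢b L′ q′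

    p : ℕ
    p = n ∸ length text

    |text|+p : length text + p ≡ n
    |text|+p = m+[n∸m]≡n (≤-trans (length-text≤ q≤L) text≤n)

    1≤n : 1 ≤ n
    1≤n = ≤-trans (m^n>0 2 22) n₀≤n

    fromNonempty : ∀ {n} (u : List (Fin (suc (suc k)))) → 1 ≤ n → length u ≡ n →
                   ∃ λ w → List⁺.toList w ≡ u × w ∈ words (suc (suc k)) n
    fromNonempty (x ∷ u) _ refl = x ∷ u , refl , word∈words (x ∷ u) refl
    fromNonempty []      () refl

    found : ∃ λ w → List⁺.toList w ≡ paddedText p × w ∈ words (suc (suc k)) n
    found = fromNonempty (paddedText p) 1≤n
      (trans (List.length-++ text) (trans (cong (length text +_) (List.length-replicate p)) |text|+p))

    w : Word (suc (suc k))
    w = proj₁ found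
    w≡ : List⁺.toList w ≡ paddedText p
    w≡ = proj₁ (proj₂ found)
    w∈ : w ∈ words (suc (suc k)) n
    w∈ = proj₂ (proj₂ found)

    F : Factorization (List⁺.toList w)
    F = factorize (List⁺.toList w)

    lz78≥ : L * (L * (q * 2)) ≤ |lz78| w
    lz78≥ = begin
      L * (L * (q * 2))               ≤⟨ 2qL²≤length-shapes ⟩
      length shapes                   ≡⟨ List.length-map word shapes ⟨
      length (List.map word shapes)
        ≤⟨ parsed-length≤m F (List.map word shapes) {v = a^ p} (Chain-map word word-mono shapes-chain)
                                           (map⁺ word-injective shapes-unique)
                                               (trans (cong (_++ a^ p) shapes-text) (sym w≡)) ⟩
      Factorization.m F               ≤⟨ n≤1+n _ ⟩
      suc (Factorization.m F)         ≤⟨ m≤size-lz78 F (λ ()) ⟩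
      |lz78| w                        ∎
      where open ≤-Reasoning

    smallest≤ : g w ≤ 51 * q
    smallest≤ = go (paddedText-SLP p (suc q) (subst (_< 2 ^ suc q) (sym |text|+p) n<2^1+q))
      where
      open ≤-Reasoning
      lem : ∀ q → 18 * suc q + 6 * q + 9 ≡ 27 * 1 + 24 * q
      lem = solve-∀
      lem′ : ∀ q → 27 * q + 24 * q ≡ 51 * q
      lem′ = solve-∀
      go : (∃ λ (𝔸 : SLP (suc (suc k))) → val 𝔸 ≡ paddedText p × size 𝔸 ≤ 18 * suc q + 6 * q + 9) → g w ≤ 51 * q
      go (𝔸 , v , le) = begin
        g w                       ≤⟨ g≤ w 𝔸 (trans v (sym w≡)) ⟩
        size 𝔸                    ≤⟨ le ⟩
        18 * suc q + 6 * q + 9    ≡⟨ lem q ⟩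
        27 * 1 + 24 * q           ≤⟨ +-monoˡ-≤ (24 * q) (*-monoʳ-≤ 27 (s≤s {0} {q′} z≤n)) ⟩
        27 * q + 24 * q           ≡⟨ lem′ q ⟩
        51 * q                    ∎

open Combinatorics

-- From natural numbers to rational cuts.

module Ratios where
  open import Data.Integer using (+_; ∣_∣; -[1+_])
  open import Data.Nat using (ℕ; zero; suc)
  open import Data.Rational
    using (ℚ; mkℚ; 0ℚ; _/_; _*_; _≤_; _<_; *≤*; *<*; ↥_; ↧ₙ_; toℚᵘ; positive; nonNegative; nonPositive;
        NonNegative)

  -- The fraction in explicit normal form: numerator and denominator are visible without evaluating
  -- the gcd in `_/_`.
  ιⁿ : ℕ → ℚ
  ιⁿ n = mkℚ (+ n) 0 (Coprimality.sym (Coprimality.1-coprimeTo n))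

  -- Opaque because unfolding the normalisation of fractions makes type checking very slow.
  opaque
    ι : ℕ → ℚ
    ι n = + n / 1

    ι≡/1 : ∀ n → ι n ≡ + n / 1
    ι≡/1 n = refl

    c₁ : ℚ
    c₁ = + 1 / 663

    c₁≡ : c₁ ≡ + 1 / 663
    c₁≡ = refl

    0<c₁ : 0ℚ < c₁
    0<c₁ = ℚ.positive⁻¹ c₁

  ι≡ιⁿ : ∀ n → ι n ≡ ιⁿ n
  ι≡ιⁿ n = trans (ι≡/1 n) (ℚ.↥p/↧p≡p (ιⁿ n))

  ι-* : ∀ m n → ι (m ℕ.* n) ≡ ι m * ι n
  ι-* m n = sym (trans (cong₂ _*_ (ι≡ιⁿ m) (ι≡ιⁿ n)) (trans (cong (_/ 1) (sym (ℤ.pos-* m n)))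
      (sym (ι≡/1 (m ℕ.* n)))))

  ι-mono : ∀ {m n} → m ℕ.≤ n → ι m ≤ ι n
  ι-mono {m} {n} m≤n = subst₂ _≤_ (sym (ι≡ιⁿ m)) (sym (ι≡ιⁿ n))
    (*≤* (ℤ.*-monoʳ-≤-nonNeg (+ 1) (ℤ.+≤+ m≤n)))

  0≤ι : ∀ n → 0ℚ ≤ ι n
  0≤ι n = subst (_≤ ι n) (ι≡ιⁿ 0) (ι-mono {0} ℕ.z≤n)

  0<ι : ∀ n .{{_ : ℕ.NonZero n}} → 0ℚ < ι n
  0<ι (suc n) = subst (0ℚ <_) (sym (ι≡ιⁿ (suc n))) (*<* (ℤ.+<+ (ℕ.s≤s ℕ.z≤n)))

  /-*ι : ∀ s n .{{_ : ℕ.NonZero n}} → (+ s / n) * ι n ≡ ι s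
  /-*ι s (suc d) = trans (cong ((+ s / suc d) *_) (ι≡ιⁿ (suc d))) (trans (ℚ.toℚᵘ-injective (begin-equality
    toℚᵘ ((+ s / suc d) * ιⁿ (suc d))              ≃⟨ ℚ.toℚᵘ-homo-* (+ s / suc d) (ιⁿ (suc d)) ⟩
    toℚᵘ (+ s / suc d) ℚᵘ.* mkℚᵘ (+ suc d) 0
      ≃⟨ ℚᵘ.*-congʳ {mkℚᵘ (+ suc d) 0} (ℚ.toℚᵘ-fromℚᵘ (mkℚᵘ (+ s) d)) ⟩
    mkℚᵘ (+ s) d ℚᵘ.* mkℚᵘ (+ suc d) 0
      ≃⟨ *≡* (trans (ℤ.*-identityʳ _) (cong (λ n → + s ℤ.* + suc n) (sym (ℕ.*-identityʳ d)))) ⟩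
    toℚᵘ (ιⁿ s)                                    ∎)) (sym (ι≡ιⁿ s)))
    where open ℚᵘ.≤-Reasoning

  *-mono-nonNeg : ∀ {p q r s} → 0ℚ ≤ p → 0ℚ ≤ s → p ≤ q → r ≤ s → p * r ≤ q * s
  *-mono-nonNeg {p} {q} {r} {s} 0≤p 0≤s p≤q r≤s = ℚ.≤-trans
    (ℚ.*-monoˡ-≤-nonNeg p {{nonNegative 0≤p}} r≤s) (ℚ.*-monoʳ-≤-nonNeg s {{nonNegative 0≤s}} p≤q)

  0≤* : ∀ {p q} → 0ℚ ≤ p → 0ℚ ≤ q → 0ℚ ≤ p * q
  0≤* 0≤p 0≤q = *-mono-nonNeg {0ℚ} {_} {0ℚ} ℚ.≤-refl 0≤q 0≤p 0≤q

  square-nonNeg : ∀ p → 0ℚ ≤ p * p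
  square-nonNeg p with ℚ.≤-total 0ℚ p
  ... | inj₁ 0≤p = 0≤* 0≤p 0≤p
  ... | inj₂ p≤0 = ℚ.≤-trans (ℚ.≤-reflexive (sym (ℚ.*-zeroʳ p))) (ℚ.*-monoˡ-≤-nonPos p {{nonPositive p≤0}} p≤0)

  cube-mono : ∀ {p q} → 0ℚ ≤ p → p ≤ q → p * p * p ≤ q * q * q
  cube-mono 0≤p p≤q = *-mono-nonNeg (0≤* 0≤p 0≤p) (ℚ.≤-trans 0≤p p≤q)
    (*-mono-nonNeg 0≤p (ℚ.≤-trans 0≤p p≤q) p≤q p≤q) p≤q

  ↥-nonNeg : ∀ {r} → 0ℚ ≤ r → ↥ r ≡ + ∣ ↥ r ∣
  ↥-nonNeg {mkℚ (+ n) _ _}    _  = refl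
  ↥-nonNeg {mkℚ -[1+ n ] _ _} 0≤ with nonNegative 0≤
  ... | ()

  ι≤ : ∀ {q r} → 0ℚ ≤ r → q ℕ.* ↧ₙ r ℕ.≤ ∣ ↥ r ∣ → ι q ≤ r
  ι≤ {q} {r} 0≤r le = subst (_≤ r) (sym (ι≡ιⁿ q)) (*≤* (subst₂ ℤ._≤_ (ℤ.pos-* q (↧ₙ r))
    (trans (sym (↥-nonNeg 0≤r)) (sym (ℤ.*-identityʳ (↥ r)))) (ℤ.+≤+ le)))

  ≤ι : ∀ {q r} → 0ℚ ≤ r → ∣ ↥ r ∣ ℕ.≤ q ℕ.* ↧ₙ r → r ≤ ι q
  ≤ι {q} {r} 0≤r le = subst (r ≤_) (sym (ι≡ιⁿ q)) (*≤* (subst₂ ℤ._≤_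
    (trans (sym (↥-nonNeg 0≤r)) (sym (ℤ.*-identityʳ (↥ r)))) (ℤ.pos-* q (↧ₙ r)) (ℤ.+≤+ le)))

  2^-cancel-< : ∀ {m n} → 2 ℕ.^ m ℕ.< 2 ℕ.^ n → m ℕ.< n
  2^-cancel-< lt = ℕ.≰⇒> λ n≤m → ℕ.<⇒≱ lt (ℕ.^-monoʳ-≤ 2 n≤m)

  -- With r = p / d, raising 2^q ≤ n to the power `d` gives 2^(q d) ≤ n^d < 2^p, and exponents are
  -- compared. Together with the dual `below-log₂` this is all that is used about logarithms.
  above-log₂ : ∀ {n q r} → 2 ℕ.^ q ℕ.≤ n → above (log₂ n) r → ι q ≤ r
  above-log₂ {n} {q} {r} 2^q≤n (0≤r , lt) = ι≤ 0≤r (ℕ.<⇒≤ (2^-cancel-< {q ℕ.* ↧ₙ r} (ℕ.≤-<-trans (begin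
    2 ℕ.^ (q ℕ.* ↧ₙ r)     ≡⟨ ℕ.^-*-assoc 2 q (↧ₙ r) ⟨
    (2 ℕ.^ q) ℕ.^ ↧ₙ r     ≤⟨ ℕ.^-monoˡ-≤ (↧ₙ r) 2^q≤n ⟩
    n ℕ.^ ↧ₙ r             ∎) lt)))
    where open ℕ.≤-Reasoning

  below-log₂ : ∀ {n q r} → n ℕ.≤ 2 ℕ.^ q → 0ℚ ≤ r → below (log₂ n) r → r ≤ ι q
  below-log₂ n≤2^q 0≤r (inj₁ r<0) = contradiction (ℚ.≤-<-trans 0≤r r<0) (ℚ.<-irrefl refl)
  below-log₂ {n} {q} {r} n≤2^q 0≤r (inj₂ lt) = ≤ι 0≤r
      (ℕ.<⇒≤ (2^-cancel-< {n = q ℕ.* ↧ₙ r} (ℕ.<-≤-trans lt (begin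
    n ℕ.^ ↧ₙ r             ≤⟨ ℕ.^-monoˡ-≤ (↧ₙ r) n≤2^q ⟩
    (2 ℕ.^ q) ℕ.^ ↧ₙ r     ≡⟨ ℕ.^-*-assoc 2 q (↧ₙ r) ⟩
    2 ℕ.^ (q ℕ.* ↧ₙ r)     ∎))))
    where open ℕ.≤-Reasoning

  open Data.List.Extrema (DecTotalOrder.totalOrder ℚ.≤-decTotalOrder) using (max≤v⁺; v≤max⁺)

  ratio≤α : ∀ 𝒞 {k n} {w : Word k} → w ∈ words k n → ratio 𝒞 w ≤ α 𝒞 k n
  ratio≤α 𝒞 w∈ = v≤max⁺ 0ℚ _ (inj₂ (lose (∈-map⁺ (ratio 𝒞) w∈) ℚ.≤-refl))

  α≤ : ∀ 𝒞 {k n c} → 0ℚ ≤ c → (∀ {w : Word k} → w ∈ words k n → ratio 𝒞 w ≤ c) → α 𝒞 k n ≤ c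
  α≤ 𝒞 0≤c le = max≤v⁺ 0≤c (All.map⁺ (All.tabulate le))

  c₂ : ℚ
  c₂ = ι 8

  -- Since q ≤ r, the inequality x³ r² < n² ≤ Y³ q² forces x < Y, so the comparison is with the
  -- integer `Y` of order L².
  lower : ∀ {k n} → Witness k n → c₁ · [ n /log]^⅔ ≤ᶜ α LZ78 k n
  lower {k} {n} W x (r , r>log , x³r²<n²) = ℚ.≤-trans c₁x≤ratio (ratio≤α LZ78 {k} {n} {w} w∈)
    where
    open Witness W
    open ℚ.≤-Reasoning
    Y : ℕ
    -- 26 is the least integer whose cube is at least 128².
    Y = 26 ℕ.* (L ℕ.* L)

    Y³q²≥n² : n ℕ.* n ℕ.≤ (Y ℕ.* Y ℕ.* Y) ℕ.* (q ℕ.* q)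
    Y³q²≥n² = ℕ.≤-trans (ℕ.*-mono-≤ n≤128qL³ n≤128qL³) (ℕ.≤-trans (ℕ.≤-reflexive (lem₁ 128 q L))
      (ℕ.≤-trans (ℕ.*-monoˡ-≤ (L ℕ.* L ℕ.* L ℕ.* (L ℕ.* L ℕ.* L) ℕ.* (q ℕ.* q))
          (ℕ.≤ᵇ⇒≤ (128 ℕ.* 128) (26 ℕ.* 26 ℕ.* 26) _))
        (ℕ.≤-reflexive (sym (lem₂ 26 q L)))))
      where
      lem₁ : ∀ c q L → c ℕ.* q ℕ.* (L ℕ.* L ℕ.* L) ℕ.* (c ℕ.* q ℕ.* (L ℕ.* L ℕ.* L)) ≡
             c ℕ.* c ℕ.* (L ℕ.* L ℕ.* L ℕ.* (L ℕ.* L ℕ.* L) ℕ.* (q ℕ.* q))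
      lem₁ = solve-∀
      lem₂ : ∀ c q L → c ℕ.* (L ℕ.* L) ℕ.* (c ℕ.* (L ℕ.* L)) ℕ.* (c ℕ.* (L ℕ.* L)) ℕ.* (q ℕ.* q) ≡
             c ℕ.* c ℕ.* c ℕ.* (L ℕ.* L ℕ.* L ℕ.* (L ℕ.* L ℕ.* L) ℕ.* (q ℕ.* q))
      lem₂ = solve-∀

    Y≰x : ¬ (ι Y ≤ x)
    Y≰x Y≤x = ℚ.<-irrefl refl (ℚ.<-≤-trans x³r²<n² (begin
      (+ n / 1) * (+ n / 1)                  ≡⟨ cong₂ _*_ (ι≡/1 n) (ι≡/1 n) ⟨
      ι n * ι n                              ≡⟨ ι-* n n ⟨
      ι (n ℕ.* n)                            ≤⟨ ι-mono Y³q²≥n² ⟩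
      ι ((Y ℕ.* Y ℕ.* Y) ℕ.* (q ℕ.* q))
        ≡⟨ trans (ι-* (Y ℕ.* Y ℕ.* Y) (q ℕ.* q))
            (cong₂ _*_ (trans (ι-* (Y ℕ.* Y) Y) (cong (_* ι Y) (ι-* Y Y))) (ι-* q q)) ⟩
      ι Y * ι Y * ι Y * (ι q * ι q)
        ≤⟨ *-mono-nonNeg (0≤* (0≤* (0≤ι Y) (0≤ι Y)) (0≤ι Y)) (square-nonNeg r) (cube-mono (0≤ι Y) Y≤x)
                                                  (*-mono-nonNeg (0≤ι q) (ℚ.≤-trans (0≤ι q) q≤r) q≤r q≤r) ⟩
      x * x * x * (r * r)                    ∎))
      where
      q≤r : ι q ≤ r
      q≤r = above-log₂ 2^q≤n r>log

    -- 663 = 26 · 51 / 2, from `Y`, the grammar bound 51 q and the 2 q L² factors; its reciprocal is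
    -- `c₁`.
    Yg≤663s : Y ℕ.* g w ℕ.≤ 663 ℕ.* |lz78| w
    Yg≤663s = ℕ.≤-trans (ℕ.*-monoʳ-≤ Y smallest≤) (ℕ.≤-trans (ℕ.≤-reflexive (lem q L)) (ℕ.*-monoʳ-≤ 663 lz78≥))
      where
      lem : ∀ q L → 26 ℕ.* (L ℕ.* L) ℕ.* (51 ℕ.* q) ≡ 663 ℕ.* (L ℕ.* (L ℕ.* (q ℕ.* 2)))
      lem = solve-∀

    0≤c₁ : NonNegative c₁
    0≤c₁ = nonNegative (ℚ.<⇒≤ 0<c₁)

    c₁*663≡1 : c₁ * ι 663 ≡ ι 1
    c₁*663≡1 = trans (cong (_* ι 663) c₁≡) (/-*ι 1 663)

    c₁x≤ratio : c₁ * x ≤ ratio LZ78 w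
    c₁x≤ratio = ℚ.*-cancelʳ-≤-pos (ι (g w)) {{positive (0<ι (g w))}} (begin
      c₁ * x * ι (g w)
        ≤⟨ ℚ.*-monoʳ-≤-nonNeg (ι (g w)) {{nonNegative (0≤ι (g w))}} (ℚ.*-monoˡ-≤-nonNeg c₁ {{0≤c₁}}
            (ℚ.<⇒≤ (ℚ.≰⇒> Y≰x))) ⟩
      c₁ * ι Y * ι (g w)
        ≡⟨ trans (ℚ.*-assoc c₁ (ι Y) (ι (g w))) (cong (c₁ *_) (sym (ι-* Y (g w)))) ⟩
      c₁ * ι (Y ℕ.* g w)           ≤⟨ ℚ.*-monoˡ-≤-nonNeg c₁ {{0≤c₁}} (ι-mono Yg≤663s) ⟩
      c₁ * ι (663 ℕ.* |lz78| w)
        ≡⟨ trans (cong (c₁ *_) (ι-* 663 (|lz78| w))) (sym (ℚ.*-assoc c₁ (ι 663) (ι (|lz78| w)))) ⟩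
      c₁ * ι 663 * ι (|lz78| w)
        ≡⟨ trans (cong (_* ι (|lz78| w)) c₁*663≡1) (trans (sym (ι-* 1 (|lz78| w)))
            (cong ι (ℕ.*-identityˡ (|lz78| w)))) ⟩
      ι (|lz78| w)                 ≡⟨ /-*ι (|lz78| w) (g w) ⟨
      ratio LZ78 w * ι (g w)       ∎)

  upper : ∀ k n → α LZ78 k n ≤ᶜ c₂ · [ n /log]^⅔
  upper k n x (r , 0≤r , r<log , n²<x³r²′) = α≤ LZ78 {k} {n} (0≤* (0≤ι 8) 0≤x) bound
    where
    open ℚ.≤-Reasoning
    n²<x³r² : ι n * ι n < x * x * x * (r * r)
    n²<x³r² = subst (λ ν → ν * ν < x * x * x * (r * r)) (sym (ι≡/1 n)) n²<x³r²′

    -- Required both for the default value 0 of the maximum in `α` and for cubing inequalities.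
    0≤x : 0ℚ ≤ x
    0≤x with ℚ.≤-total 0ℚ x
    ... | inj₁ 0≤x = 0≤x
    ... | inj₂ x≤0 = contradiction (ℚ.<-≤-trans n²<x³r² (begin
      x * x * x * (r * r)
        ≡⟨ solve 2 (λ x r → x :* x :* x :* (r :* r) := (x :* x) :* (r :* r) :* x) refl x r ⟩
      x * x * (r * r) * x
        ≤⟨ ℚ.*-monoˡ-≤-nonNeg (x * x * (r * r)) {{nonNegative (0≤* (square-nonNeg x) (square-nonNeg r))}} x≤0 ⟩
      x * x * (r * r) * 0ℚ     ≡⟨ ℚ.*-zeroʳ (x * x * (r * r)) ⟩
      0ℚ                       ≤⟨ square-nonNeg (ι n) ⟩
      ι n * ι n                ∎)) (ℚ.<-irrefl refl)
      where open +-*-Solver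

    bound : ∀ {w : Word k} → w ∈ words k n → ratio LZ78 w ≤ c₂ * x
    bound {w} w∈ = ℚ.*-cancelʳ-≤-pos (ι γ) {{positive (0<ι γ)}} (ℚ.≤-trans (ℚ.≤-reflexive (/-*ι s γ)) s≤Z)
      where
      s γ : ℕ
      s = |lz78| w
      γ = g w
      |w|≡n : List⁺.length w ≡ n
      |w|≡n = ∈words-length w∈
      Z : ℚ
      Z = c₂ * x * ι γ
      0≤Z : 0ℚ ≤ Z
      0≤Z = 0≤* (0≤* (0≤ι 8) 0≤x) (0≤ι γ)
      r≤γ : r ≤ ι γ
      r≤γ = below-log₂ (subst (ℕ._≤ 2 ℕ.^ γ) |w|≡n (n≤2^g w)) 0≤r r<log
      s³≤ : s ℕ.* s ℕ.* s ℕ.≤ 512 ℕ.* γ ℕ.* (n ℕ.* n)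
      s³≤ = subst (λ n → s ℕ.* s ℕ.* s ℕ.≤ 512 ℕ.* γ ℕ.* (n ℕ.* n)) |w|≡n (|lz78|³≤ w)
      0<512γ : 0ℚ < ι (512 ℕ.* γ)
      0<512γ = 0<ι (512 ℕ.* γ) {{ℕ.m*n≢0 512 γ}}
      s≤Z : ι s ≤ Z
      s≤Z with ℚ.≤-total (ι s) Z
      ... | inj₁ s≤Z = s≤Z
      -- Cubes replace cube roots: r ≤ γ turns 512 γ x³ r² into at most 512 γ³ x³, which is the cube
      -- of Z = 8 x γ, and the strict step comes from n² < x³ r².
      ... | inj₂ Z≤s = contradiction (begin-strict
        Z * Z * Z                                ≤⟨ cube-mono 0≤Z Z≤s ⟩
        ι s * ι s * ι s                          ≡⟨ trans (ι-* (s ℕ.* s) s) (cong (_* ι s) (ι-* s s)) ⟨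
        ι (s ℕ.* s ℕ.* s)                        ≤⟨ ι-mono s³≤ ⟩
        ι (512 ℕ.* γ ℕ.* (n ℕ.* n))
          ≡⟨ trans (ι-* (512 ℕ.* γ) (n ℕ.* n)) (cong (ι (512 ℕ.* γ) *_) (ι-* n n)) ⟩
        ι (512 ℕ.* γ) * (ι n * ι n)
          <⟨ ℚ.*-monoʳ-<-pos (ι (512 ℕ.* γ)) {{positive 0<512γ}} n²<x³r² ⟩
        ι (512 ℕ.* γ) * (x * x * x * (r * r))
          ≤⟨ ℚ.*-monoˡ-≤-nonNeg (ι (512 ℕ.* γ)) {{nonNegative (0≤ι (512 ℕ.* γ))}}
                                                      (ℚ.*-monoˡ-≤-nonNeg (x * x * x)
                                                          {{nonNegative (0≤* (square-nonNeg x) 0≤x)}}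
                                                          (*-mono-nonNeg 0≤r (0≤ι γ) r≤γ r≤γ)) ⟩
        ι (512 ℕ.* γ) * (x * x * x * (ι γ * ι γ))
          ≡⟨ cong (_* (x * x * x * (ι γ * ι γ)))
              (trans (ι-* 512 γ) (cong (_* ι γ) (trans (ι-* 64 8) (cong (_* ι 8) (ι-* 8 8))))) ⟩
        c₂ * c₂ * c₂ * ι γ * (x * x * x * (ι γ * ι γ))
          ≡⟨ solve 3 (λ c x γ → c :* c :* c :* γ :* (x :* x :* x :* (γ :* γ)) := c :* x :* γ :*
              (c :* x :* γ) :* (c :* x :* γ)) refl c₂ x (ι γ) ⟩
        Z * Z * Z                                ∎) (ℚ.<-irrefl refl)
        where open +-*-Solver

open Ratios

open import Data.Nat using (ℕ; _≤_)
open import Data.Rational using (ℚ; 0ℚ; _<_)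

theorem3p4 :
    ∃[ c₁ ] ∃[ c₂ ] ∃[ n₀ ]
      (0ℚ < c₁ × 0ℚ < c₂ ×
       (∀ (n k : ℕ) → n₀ ≤ n → 2 ≤ k → k ≤ n →
         (c₁ · [ n /log]^⅔ ≤ᶜ α LZ78 k n) × (α LZ78 k n ≤ᶜ c₂ · [ n /log]^⅔)))
theorem3p4 = c₁ , c₂ , 2 ℕ.^ 22 , 0<c₁ , 0<ι 8 ,
  λ n k n₀≤n 2≤k _ → lower (witness k n 2≤k n₀≤n) , upper k n
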